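{- Let $N\geq 2$, $M\geq 1$ be integers and let $R$ be a positive integer. Let $\Lambda_1,\dots,\Lambda_M$ be sublattices of $\mathbb{Z}^N$ of rank $N-1$ each, such that $C_R^N \cap \mathbb{Z}^N \subset \bigcup_{i=1}^M \Lambda_i$. Then $$\sum_{i=1}^M \frac{1}{H(\Lambda_i)} \geq R-\sqrt{M}.$$
   Context: $C_R^N=\{\boldsymbol{x}\in\mathbb{R}^N:\max_{1\leq i\leq N}|x_i|\leq R\}$ is the closed cube of sidelength $2R$ centered at the origin. For a lattice (subgroup) $\Lambda\subseteq\mathbb{Z}^N$ of rank $J$, $1\leq J\leq N$, choose a $\mathbb{Z}$-basis $\boldsymbol{x}_1,\dots,\boldsymbol{x}_J$ and let $X=(\boldsymbol{x}_1\ \dots\ \boldsymbol{x}_J)$ be the $N\times J$ basis matrix. For each subset $I\subseteq\{1,\dots,N\}$ of cardinality $J$ let $X_I$ be the $J\times J$ submatrix formed by the rows of $X$ indexed by $I$. The height of the lattice is $H(\Lambda)=\max_{I}|\det(X_I)|$, which does not depend on the choice of basis. -}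

module Defs where

open import Data.Empty using (⊥)
open import Data.Fin.Base as Fin using (Fin; zero; suc; toℕ; punchIn)
open import Data.Fin.Subset using (Subset; inside; outside; ∣_∣)
open import Data.Integer.Base as ℤ using (ℤ; 0ℤ; -1ℤ)
import Data.Integer.Properties as ℤₚ
open import Data.List.Base as List using (List; []; _∷_; _++_)
open import Data.List.Extrema.Nat using (max)
open import Data.Nat.Base as ℕ using (ℕ; zero; suc)
open import Data.Product.Base using (Σ; ∃; _×_; _,_)
open import Data.Rational.Base hiding (∣_∣)
open import Data.Rational.Properties
open import Data.Rational.Solver using (module +-*-Solver)
open import Data.Sum.Base using (_⊎_; inj₁; inj₂; swap)
open import Data.Vec.Base as Vec using (Vec; []; _∷_; lookup; replicate; zipWith; tabulate)
open import Data.Vec.Functional using (Vector)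
open import Level using (0ℓ)
open import Relation.Binary.Definitions using (tri<; tri≈; tri>)
open import Relation.Binary.PropositionalEquality
open import Relation.Nullary.Decidable.Core using (yes; no)
open import Relation.Nullary.Negation.Core using (contradiction)
open import Relation.Unary using (Pred; _∈_)

import Algebra.Properties.CommutativeMonoid.Sum as Sum
module ∑ℤ = Sum ℤₚ.+-0-commutativeMonoid
module ∑ℚ = Sum +-0-commutativeMonoid

------------------------------------------------------------------------
-- Matrices

Matrix : ℕ → ℕ → Set
Matrix m n = Fin m → Fin n → ℤ

-- Laplace expansion along the first row.
det : ∀ {n} → Matrix n n → ℤ
det {zero}  A = ℤ.1ℤ
det {suc n} A = ∑ℤ.sum λ j →
  (-1ℤ ℤ.^ toℕ j) ℤ.* A zero j ℤ.* det (λ r c → A (suc r) (punchIn j c))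

-- The members of a subset, listed in increasing order.
member : ∀ {n} (I : Subset n) → Fin ∣ I ∣ → Fin n
member (inside  ∷ I) zero    = zero
member (inside  ∷ I) (suc k) = suc (member I k)
member (outside ∷ I) k       = suc (member I k)

SubsetOfSize : ℕ → ℕ → Set
SubsetOfSize n k = Σ (Subset n) λ I → ∣ I ∣ ≡ k

subsetsOfSize : ∀ n k → List (SubsetOfSize n k)
subsetsOfSize zero    zero    = ([] , refl) ∷ []
subsetsOfSize zero    (suc k) = []
subsetsOfSize (suc n) zero    =
  List.map (λ (I , e) → outside ∷ I , e) (subsetsOfSize n zero)
subsetsOfSize (suc n) (suc k) =
  List.map (λ (I , e) → inside  ∷ I , cong suc e) (subsetsOfSize n k) ++
  List.map (λ (I , e) → outside ∷ I , e) (subsetsOfSize n (suc k))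

rows : ∀ {n k} → Matrix n k → SubsetOfSize n k → Matrix k k
rows X (I , e) r c = X (member I (Fin.cast (sym e) r)) c

-- `max 0` is the maximum with default value 0; all the entries are
-- natural numbers, so the default never alters the maximum.
maxMinor : ∀ {n k} → Matrix n k → ℕ
maxMinor {n} {k} X = max 0 (List.map (λ I → ℤ.∣ det (rows X I) ∣) (subsetsOfSize n k))

------------------------------------------------------------------------
-- Lattices

record Sublattice (N : ℕ) : Set₁ where
  field
    Carrier  : Pred (Vec ℤ N) 0ℓ
    0-closed : replicate N 0ℤ ∈ Carrier
    +-closed : ∀ {x y} → x ∈ Carrier → y ∈ Carrier → zipWith ℤ._+_ x y ∈ Carrier
    neg-closed : ∀ {x} → x ∈ Carrier → Vec.map ℤ.-_ x ∈ Carrier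

basisMatrix : ∀ {N J} → Vector (Vec ℤ N) J → Matrix N J
basisMatrix x r c = lookup (x c) r

combination : ∀ {N J} → Vector (Vec ℤ N) J → Vector ℤ J → Vec ℤ N
combination x a = tabulate λ r → ∑ℤ.sum λ c → a c ℤ.* basisMatrix x r c

record Basis {N : ℕ} (Λ : Sublattice N) (J : ℕ) : Set where
  open Sublattice Λ
  field
    vectors     : Vector (Vec ℤ N) J
    contained   : ∀ c → vectors c ∈ Carrier
    independent : ∀ a → combination vectors a ≡ replicate N 0ℤ → ∀ c → a c ≡ 0ℤ
    spanning    : ∀ {x} → x ∈ Carrier → ∃ λ a → combination vectors a ≡ x

-- The height of Λ, computed from a chosen basis of Λ.
height : ∀ {N J} {Λ : Sublattice N} → Basis Λ J → ℕ
height B = maxMinor (basisMatrix (Basis.vectors B))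

-- The integer points of the cube of sidelength 2R centred at the origin.
Cube : ∀ {N} → ℕ → Pred (Vec ℤ N) 0ℓ
Cube R x = ∀ i → ℤ.∣ lookup x i ∣ ℕ.≤ R

fromℕ : ℕ → ℚ
fromℕ n = ℤ.+ n / 1

-- Total by the convention 1/0 = 0.  Heights are never 0: a basis matrix
-- has independent columns, hence a nonzero maximal minor.
reciprocal : ℕ → ℚ
reciprocal zero    = 0ℚ
reciprocal (suc n) = ℤ.+ 1 / suc n

------------------------------------------------------------------------
-- Real numbers, as two-sided Dedekind cuts of ℚ

record ℝ : Set₁ where
  field
    L U         : Pred ℚ 0ℓ
    L-inhabited : ∃ L
    U-inhabited : ∃ U
    L-closed    : ∀ {p q} → p < q → L q → L p
    U-closed    : ∀ {p q} → p < q → U p → U q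
    L-open      : ∀ {p} → L p → ∃ λ q → p < q × L q
    U-open      : ∀ {q} → U q → ∃ λ p → p < q × U p
    disjoint    : ∀ {q} → L q → U q → ⊥
    located     : ∀ {p q} → p < q → L p ⊎ U q

infix 4 _≤ᵣ_
_≤ᵣ_ : ℝ → ℝ → Set
x ≤ᵣ y = ∀ {q} → ℝ.L x q → ℝ.L y q

private
  p-1<p : ∀ p → p - 1ℚ < p
  p-1<p p = subst (p - 1ℚ <_) (+-identityʳ p) (+-monoʳ-< p (negative⁻¹ (- 1ℚ)))

  p<p+1 : ∀ p → p < p + 1ℚ
  p<p+1 p = subst (_< p + 1ℚ) (+-identityʳ p) (+-monoʳ-< p (positive⁻¹ 1ℚ))

fromℚ : ℚ → ℝ
fromℚ x = record
  { L = _< x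
  ; U = x <_
  ; L-inhabited = x - 1ℚ , p-1<p x
  ; U-inhabited = x + 1ℚ , p<p+1 x
  ; L-closed = <-trans
  ; U-closed = λ p<q x<p → <-trans x<p p<q
  ; L-open = λ p<x → let q , p<q , q<x = <-dense p<x in q , p<q , q<x
  ; U-open = λ x<q → let p , x<p , p<q = <-dense x<q in p , p<q , x<p
  ; disjoint = <-asym
  ; located = loc
  }
  where
  loc : ∀ {p q} → p < q → p < x ⊎ x < q
  loc {p} p<q with <-cmp p x
  ... | tri< p<x _ _ = inj₁ p<x
  ... | tri≈ _ refl _ = inj₂ p<q
  ... | tri> _ _ x<p = inj₂ (<-trans x<p p<q)

-- Subtraction of a real number from a rational one.
infixl 6 _-ᵣ_
_-ᵣ_ : ℚ → ℝ → ℝ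
r -ᵣ y = record
  { L = λ q → U (r - q)
  ; U = λ q → L (r - q)
  ; L-inhabited = let u , h = U-inhabited in r - u , subst U (sym (flip-flip u)) h
  ; U-inhabited = let l , h = L-inhabited in r - l , subst L (sym (flip-flip l)) h
  ; L-closed = λ p<q → U-closed (flip-< p<q)
  ; U-closed = λ p<q → L-closed (flip-< p<q)
  ; L-open = λ {p} h → let u , u<r-p , k = U-open h in
      r - u , subst (_< r - u) (flip-flip p) (flip-< u<r-p) , subst U (sym (flip-flip u)) k
  ; U-open = λ {q} h → let l , r-q<l , k = L-open h in
      r - l , subst (r - l <_) (flip-flip q) (flip-< r-q<l) , subst L (sym (flip-flip l)) k
  ; disjoint = λ u l → disjoint l u
  ; located = λ p<q → swap (located (flip-< p<q))
  }
  where
  open ℝ y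
  flip-flip : ∀ q → r - (r - q) ≡ q
  flip-flip q = solve 2 (λ r q → r :- (r :- q) := q) refl r q
    where open +-*-Solver
  flip-< : ∀ {p q} → p < q → r - q < r - p
  flip-< p<q = +-monoʳ-< r (neg-antimono-< p<q)

private
  *-pos : ∀ {p q} → 0ℚ < p → 0ℚ < q → 0ℚ < p * q
  *-pos {p} {q} 0<p 0<q =
    positive⁻¹ (p * q) {{pos*pos⇒pos p {{positive 0<p}} q {{positive 0<q}}}}

  <⇒0<- : ∀ {p q} → p < q → 0ℚ < q - p
  <⇒0<- {p} {q} p<q = subst (_< q - p) (+-inverseʳ p) (+-monoˡ-< (- p) p<q)

  0<-⇒< : ∀ {p q} → 0ℚ < q - p → p < q
  0<-⇒< {p} {q} h = subst₂ _<_ (+-identityˡ p)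
    (solve 2 (λ p q → q :- p :+ p := q) refl p q) (+-monoˡ-< p h)
    where open +-*-Solver

  square-mono : ∀ {p q} → 0ℚ ≤ p → p < q → p * p < q * q
  square-mono {p} {q} 0≤p p<q = ≤-<-trans
    (*-monoˡ-≤-nonNeg p {{nonNegative 0≤p}} (<⇒≤ p<q))
    (*-monoˡ-<-pos q {{positive (≤-<-trans 0≤p p<q)}} p<q)

  -- For p ≥ 0 and m ≥ 0 the number q = (p c + m) / (p + c), c = m + 1, lies
  -- strictly between p and √m unless p = √m.
  module Refine (m : ℚ) (0≤m : 0ℚ ≤ m) {p : ℚ} (0≤p : 0ℚ ≤ p) where
    c d : ℚ
    c = m + 1ℚ
    d = p + c

    0<c : 0ℚ < c
    0<c = ≤-<-trans 0≤m (p<p+1 m)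

    0<d : 0ℚ < d
    0<d = subst (_< d) (+-identityʳ 0ℚ) (+-mono-≤-< 0≤p 0<c)

    instance
      d-pos : Positive d
      d-pos = positive 0<d
      d-nonNeg : NonNegative d
      d-nonNeg = nonNegative (<⇒≤ 0<d)
      d-nonZero : NonZero d
      d-nonZero = pos⇒nonZero d

    q : ℚ
    q = (p * c + m) * 1/ d

    qd : q * d ≡ p * c + m
    qd = trans (*-assoc (p * c + m) (1/ d) d)
         (trans (cong ((p * c + m) *_) (*-inverseˡ d)) (*-identityʳ (p * c + m)))

    0<c²-m : 0ℚ < c * c - m
    0<c²-m = subst (0ℚ <_)
      (solve 1 (λ m → m :* m :+ (m :+ con 1ℚ) := (m :+ con 1ℚ) :* (m :+ con 1ℚ) :- m) refl m)
      (subst (_< m * m + c) (+-identityʳ 0ℚ) (+-mono-≤-< 0≤m*m 0<c))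
      where
      open +-*-Solver
      0≤m*m : 0ℚ ≤ m * m
      0≤m*m = subst (_≤ m * m) (*-zeroˡ m) (*-monoʳ-≤-nonNeg m {{nonNegative 0≤m}} 0≤m)

    -- (m - q²) d² = (c² - m) (m - p²)
    gap : (m - q * q) * (d * d) ≡ (c * c - m) * (m - p * p)
    gap = trans
      (solve 3 (λ m q d → (m :- q :* q) :* (d :* d) := m :* (d :* d) :- (q :* d) :* (q :* d)) refl m q d)
      (trans (cong (λ z → m * (d * d) - z * z) qd)
      (solve 3 (λ m p c → m :* ((p :+ c) :* (p :+ c)) :- (p :* c :+ m) :* (p :* c :+ m)
                          := (c :* c :- m) :* (m :- p :* p)) refl m p c))
      where open +-*-Solver

    -- (q - p) d = m - p²
    step : (q - p) * d ≡ m - p * p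
    step = trans
      (solve 3 (λ q p d → (q :- p) :* d := q :* d :- p :* d) refl q p d)
      (trans (cong (λ z → z - p * d) qd)
      (solve 3 (λ m p c → (p :* c :+ m) :- p :* (p :+ c) := m :- p :* p) refl m p c))
      where open +-*-Solver

    cancel : ∀ {x} e → 0ℚ < e → 0ℚ < x * e → 0ℚ < x
    cancel {x} e 0<e h = *-cancelʳ-<-nonNeg e {{nonNegative (<⇒≤ 0<e)}}
      (subst (_< x * e) (sym (*-zeroˡ e)) h)

    below : p * p < m → p < q × q * q < m
    below h =
        0<-⇒< (cancel d 0<d (subst (0ℚ <_) (sym step) (<⇒0<- h)))
      , 0<-⇒< (cancel (d * d) (*-pos 0<d 0<d)
          (subst (0ℚ <_) (sym gap) (*-pos 0<c²-m (<⇒0<- h))))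

    above : 0ℚ < p → m < p * p → q < p × 0ℚ < q × m < q * q
    above 0<p h =
        0<-⇒< (cancel d 0<d (subst (0ℚ <_) step′ (<⇒0<- h)))
      , cancel d 0<d (subst (0ℚ <_) (sym qd)
          (subst (_< p * c + m) (+-identityʳ 0ℚ) (+-mono-<-≤ (*-pos 0<p 0<c) 0≤m)))
      , 0<-⇒< (cancel (d * d) (*-pos 0<d 0<d)
          (subst (0ℚ <_) gap′ (*-pos 0<c²-m (<⇒0<- h))))
      where
      open +-*-Solver
      step′ : p * p - m ≡ (p - q) * d
      step′ = trans (solve 2 (λ x y → x :- y := :- (y :- x)) refl (p * p) m)
        (trans (cong -_ (sym step))
        (solve 3 (λ q p d → :- ((q :- p) :* d) := (p :- q) :* d) refl q p d))
      gap′ : (c * c - m) * (p * p - m) ≡ (q * q - m) * (d * d)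
      gap′ = trans
        (solve 3 (λ k x y → k :* (x :- y) := :- (k :* (y :- x))) refl (c * c - m) (p * p) m)
        (trans (cong -_ (sym gap))
        (solve 3 (λ x y e → :- ((y :- x) :* e) := (x :- y) :* e) refl (q * q) m (d * d)))

√ : ℕ → ℝ
√ n = record
  { L = λ q → q < 0ℚ ⊎ q * q < m
  ; U = λ q → 0ℚ < q × m < q * q
  ; L-inhabited = - 1ℚ , inj₁ (negative⁻¹ (- 1ℚ))
  ; U-inhabited = m + 1ℚ , 0<c , 0<-⇒< 0<c²-m
  ; L-closed = L-closed
  ; U-closed = λ { p<q (0<p , h) → <-trans 0<p p<q , <-trans h (square-mono (<⇒≤ 0<p) p<q) }
  ; L-open = L-open
  ; U-open = λ { (0<q , h) → let a , b , e = Refine.above m 0≤m (<⇒≤ 0<q) 0<q h in _ , a , b , e }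
  ; disjoint = λ { (inj₁ q<0) (0<q , _) → <-asym q<0 0<q ; (inj₂ h) (_ , k) → <-asym h k }
  ; located = located
  }
  where
  m : ℚ
  m = fromℕ n

  0≤m : 0ℚ ≤ m
  0≤m = nonNegative⁻¹ m {{normalize-nonNeg n 1}}

  open Refine m 0≤m {0ℚ} ≤-refl using (0<c; 0<c²-m)

  L-closed : ∀ {p q} → p < q → q < 0ℚ ⊎ q * q < m → p < 0ℚ ⊎ p * p < m
  L-closed p<q (inj₁ q<0) = inj₁ (<-trans p<q q<0)
  L-closed {p} p<q (inj₂ h) with p <? 0ℚ
  ... | yes p<0 = inj₁ p<0
  ... | no  p≮0 = inj₂ (<-trans (square-mono (≮⇒≥ p≮0) p<q) h)

  L-open : ∀ {p} → p < 0ℚ ⊎ p * p < m → ∃ λ q → p < q × (q < 0ℚ ⊎ q * q < m)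
  L-open {p} h with p <? 0ℚ
  ... | yes p<0 = let q , p<q , q<0 = <-dense p<0 in q , p<q , inj₁ q<0
  ... | no  p≮0 with h
  ...   | inj₁ p<0 = contradiction p<0 p≮0
  ...   | inj₂ k = let a , b = Refine.below m 0≤m (≮⇒≥ p≮0) k in _ , a , inj₂ b

  located : ∀ {p q} → p < q → (p < 0ℚ ⊎ p * p < m) ⊎ (0ℚ < q × m < q * q)
  located {p} p<q with p <? 0ℚ | p * p <? m
  ... | yes p<0 | _     = inj₁ (inj₁ p<0)
  ... | no  _   | yes h = inj₁ (inj₂ h)
  ... | no  p≮0 | no  k = inj₂ ( ≤-<-trans (≮⇒≥ p≮0) p<q
                               , ≤-<-trans (≮⇒≥ k) (square-mono (≮⇒≥ p≮0) p<q))

{-# OPTIONS --safe #-}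

-- Put n = 2R + 1.  A lattice of rank J = N - 1 contains at most
-- (2R/H + 1) n^(J-1) of the n^N integer points of the cube: project to J
-- coordinates on which the minor is ±H, bring the first row of the basis
-- matrix to the shape (d, 0, …, 0) by column operations, and slice along the
-- first coordinate.  The occupied slices are d apart and each one is governed
-- by the remaining minor ±H/d, so the bound follows by induction from
-- (2R/d + 1)(2R/d′ + 1) ≤ (2R/(dd′) + 1) n.  Adding up over a cover of the cube
-- gives n² ≤ 2R ∑ 1/H + M; if ∑ 1/H were at most R - s with s² > M, then
-- s ≤ R and the right-hand side would be less than 3R².
module Submission where

open import Data.Fin.Base as Fin using (Fin; zero; suc; toℕ; punchIn; punchOut; inject₁)
open import Data.Fin.Induction using (<-weakInduction)
open import Data.Fin.Properties as Finₚ using (_≟_; punchIn-punchOut; punchIn-injective; punchInᵢ≢i; toℕ-inject₁)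
open import Data.Fin.Subset using (inside; outside)
open import Data.Integer.Base as ℤ using (ℤ; 0ℤ; 1ℤ; -1ℤ; _+_; _*_; -_; _-_)
open import Data.Integer.DivMod using (n%d<d; a≡a%n+[a/n]*n)
open import Data.Integer.Properties as ℤₚ
  using (+-assoc; +-identityˡ; +-identityʳ; +-inverseʳ; *-comm; *-identityˡ; *-zeroˡ; *-zeroʳ; -1*i≡-i; i*j≡0⇒i≡0∨j≡0; ∣i∣≡0⇒i≡0)
open import Data.Integer.Tactic.RingSolver using (solve-∀)
open import Data.List.Base as List using (List)
open import Data.List.Extrema.Nat using (argmax-sel; xs≤max)
open import Data.List.Membership.Propositional using () renaming (_∈_ to _∈ˡ_)
open import Data.List.Membership.Propositional.Properties using (∈-map⁺; ∈-map⁻; ∈-++⁺ˡ; ∈-++⁺ʳ)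
import Data.List.Relation.Unary.All as All
open import Data.List.Relation.Unary.Any using (here)
open import Data.Nat.Base as ℕ using (ℕ; zero; suc; _≤_; _∸_)
open import Data.Nat.Properties as ℕₚ using ()
import Data.Nat.Tactic.RingSolver as ℕSolver
open import Data.Product.Base using (∃; _×_; _,_; proj₁; proj₂)
open import Data.Rational.Base as ℚ using (ℚ; 0ℚ; 1ℚ; fromℚᵘ)
open import Data.Rational.Properties as ℚₚ using ()
import Data.Rational.Solver as ℚSolver
open import Data.Rational.Unnormalised.Base as ℚᵘ using (ℚᵘ; mkℚᵘ)
import Data.Rational.Unnormalised.Properties as ℚᵘₚ
open import Data.Sum.Base using (_⊎_; inj₁; inj₂)
open import Data.Vec.Base as Vec using (Vec; []; _∷_; lookup)
open import Data.Vec.Functional using (Vector; updateAt) renaming (_∷_ to _◂_)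
open import Data.Vec.Functional.Properties using (updateAt-updates; updateAt-minimal)
open import Data.Vec.Properties
  using (lookup-map; lookup-zipWith; lookup∘tabulate; tabulate∘lookup; tabulate-cong; lookup-replicate)
open import Function.Base using (_∘_)
open import Relation.Binary.PropositionalEquality
open import Relation.Nullary.Decidable.Core using (yes; no)
open import Relation.Nullary.Negation.Core using (contradiction)
open import Relation.Unary using (_∈_)
open import Defs

import Algebra.Properties.Semiring.Sum as SemiringSum
module ∑ℕ = SemiringSum ℕₚ.+-*-semiring
open SemiringSum ℤₚ.+-*-semiring using (*-distribˡ-sum)
open ∑ℤ using (sum; sum-cong-≗; sum-replicate-zero; ∑-distrib-+)

-- Finite sums and adjacent indices

sum-zero : ∀ {n} {t : Vector ℤ n} → (∀ i → t i ≡ 0ℤ) → sum t ≡ 0ℤ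
sum-zero {n} eq = trans (sum-cong-≗ eq) (sum-replicate-zero n)

sum-head : ∀ {n} {t : Vector ℤ (suc n)} → (∀ i → t (suc i) ≡ 0ℤ) → sum t ≡ t zero
sum-head {t = t} eq = trans (cong (t zero +_) (sum-zero eq)) (+-identityʳ _)

sum-linear : ∀ {n} k {t u v : Vector ℤ n} → (∀ i → t i ≡ u i + k * v i) →
             sum t ≡ sum u + k * sum v
sum-linear k {t} {u} {v} eq = trans (sum-cong-≗ eq)
  (trans (∑-distrib-+ u (λ i → k * v i)) (cong (sum u +_) (sym (*-distribˡ-sum k v))))

sum-updateAt : ∀ {n} (a x : Vector ℤ n) q e →
  (sum λ c → a c * updateAt x q (_+ e) c) ≡ (sum λ c → a c * x c) + a q * e
sum-updateAt a x zero    e = lemma (a zero) (x zero) e _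
  where
  lemma : ∀ a x e s → a * (x + e) + s ≡ a * x + s + a * e
  lemma = solve-∀
sum-updateAt a x (suc q) e =
  trans (cong (a zero * x zero +_) (sum-updateAt (a ∘ suc) (x ∘ suc) q e))
        (sym (+-assoc (a zero * x zero) _ _))

-- The column reduction operates on neighbouring columns, and this relation survives the deletion of
-- a third column, as the Laplace recursion requires.
data Adjacent : ∀ {n} → Fin n → Fin n → Set where
  here  : ∀ {n} → Adjacent {suc (suc n)} zero (suc zero)
  there : ∀ {n} {p q : Fin n} → Adjacent p q → Adjacent (suc p) (suc q)

adjacent-inject₁ : ∀ {n} (i : Fin n) → Adjacent (inject₁ i) (suc i)
adjacent-inject₁ zero    = here
adjacent-inject₁ (suc i) = there (adjacent-inject₁ i)

adjacent⇒toℕ : ∀ {n} {p q : Fin n} → Adjacent p q → toℕ q ≡ suc (toℕ p)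
adjacent⇒toℕ here      = refl
adjacent⇒toℕ (there a) = cong suc (adjacent⇒toℕ a)

adjacent⇒≢ : ∀ {n} {p q : Fin n} → Adjacent p q → p ≢ q
adjacent⇒≢ (there a) refl = adjacent⇒≢ a refl

adjacent-punchOut : ∀ {n} {p q j : Fin (suc n)} (j≢p : j ≢ p) (j≢q : j ≢ q) →
  Adjacent p q → Adjacent (punchOut j≢p) (punchOut j≢q)
adjacent-punchOut {j = zero}              j≢p j≢q here = contradiction refl j≢p
adjacent-punchOut {j = suc zero}          j≢p j≢q here = contradiction refl j≢q
adjacent-punchOut {suc (suc n)} {j = suc (suc j)} j≢p j≢q here = here
adjacent-punchOut {j = zero}              j≢p j≢q (there a) = a
adjacent-punchOut {suc n} {j = suc j}     j≢p j≢q (there a) =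
  there (adjacent-punchOut (j≢p ∘ cong suc) (j≢q ∘ cong suc) a)

-- Skipping p and skipping q give the same enumeration except at one slot, where the first passes
-- through q and the second through p. If columns p and q agree, deleting either one therefore gives
-- the same minor.
punchIn-adjacent : ∀ {n} {p q : Fin (suc n)} → Adjacent p q → ∀ c →
  punchIn p c ≡ punchIn q c ⊎ (punchIn p c ≡ q × punchIn q c ≡ p)
punchIn-adjacent here      zero    = inj₂ (refl , refl)
punchIn-adjacent here      (suc c) = inj₁ refl
punchIn-adjacent (there a) zero    = inj₁ refl
punchIn-adjacent (there a) (suc c) with punchIn-adjacent a c
... | inj₁ eq        = inj₁ (cong suc eq)
... | inj₂ (e₁ , e₂) = inj₂ (cong suc e₁ , cong suc e₂)

sum-adjacent : ∀ {n} {t : Vector ℤ n} {p q} → Adjacent p q →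
  (∀ j → j ≢ p → j ≢ q → t j ≡ 0ℤ) → t p + t q ≡ 0ℤ → sum t ≡ 0ℤ
sum-adjacent {t = t} here off on =
  trans (sym (+-assoc (t zero) (t (suc zero)) _))
  (cong₂ _+_ on (sum-zero λ i → off (suc (suc i)) (λ ()) (λ ())))
sum-adjacent (there a) off on =
  cong₂ _+_ (off zero (λ ()) (λ ()))
    (sum-adjacent a (λ j j≢p j≢q → off (suc j) (j≢p ∘ Finₚ.suc-injective) (j≢q ∘ Finₚ.suc-injective)) on)

-- Determinants

minor : ∀ {m n} → Fin (suc n) → Matrix (suc m) (suc n) → Matrix m n
minor j A r c = A (suc r) (punchIn j c)

laplaceTerm : ∀ {n} → Matrix (suc n) (suc n) → Vector ℤ (suc n)
laplaceTerm A j = (-1ℤ ℤ.^ toℕ j) * A zero j * det (minor j A)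

det-cong : ∀ {n} {A B : Matrix n n} → (∀ r c → A r c ≡ B r c) → det A ≡ det B
det-cong {zero}  eq = refl
det-cong {suc n} eq = sum-cong-≗ λ j →
  cong₂ _*_ (cong ((-1ℤ ℤ.^ toℕ j) *_) (eq zero j)) (det-cong λ r c → eq (suc r) (punchIn j c))

-- In the Laplace term at j = q the three minors coincide and the entry splits. At j ≠ q the entries
-- coincide and the minor splits by induction, its special column being `punchOut j≢q`.
det-linear : ∀ {n} (q : Fin n) k {X Y Z : Matrix n n} →
  (∀ r → Z r q ≡ X r q + k * Y r q) →
  (∀ r c → c ≢ q → Z r c ≡ X r c) → (∀ r c → c ≢ q → Y r c ≡ X r c) →
  det Z ≡ det X + k * det Y
det-linear {suc n} q k {X} {Y} {Z} atq Z≡X Y≡X = sum-linear k {laplaceTerm Z} {laplaceTerm X} {laplaceTerm Y} term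
  where
  off : ∀ {j} (j≢q : j ≢ q) c → c ≢ punchOut j≢q → punchIn j c ≢ q
  off j≢q c c≢ eq = c≢ (punchIn-injective _ c _ (trans eq (sym (punchIn-punchOut j≢q))))
  term : ∀ j → laplaceTerm Z j ≡ laplaceTerm X j + k * laplaceTerm Y j
  term j with j ≟ q
  ... | yes refl
    rewrite atq zero
          | det-cong {A = minor j Z} {minor j X} (λ r c → Z≡X (suc r) _ (punchInᵢ≢i j c))
          | det-cong {A = minor j Y} {minor j X} (λ r c → Y≡X (suc r) _ (punchInᵢ≢i j c))
    = lemma (-1ℤ ℤ.^ toℕ j) (X zero j) (Y zero j) k (det (minor j X))
    where
    lemma : ∀ s x y k d → s * (x + k * y) * d ≡ s * x * d + k * (s * y * d)
    lemma = solve-∀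
  ... | no j≢q
    rewrite Z≡X zero j j≢q | Y≡X zero j j≢q
          | det-linear (punchOut j≢q) k {minor j X} {minor j Y} {minor j Z}
              (λ r → subst (λ c → Z (suc r) c ≡ X (suc r) c + k * Y (suc r) c)
                       (sym (punchIn-punchOut j≢q)) (atq (suc r)))
              (λ r c c≢ → Z≡X (suc r) _ (off j≢q c c≢))
              (λ r c c≢ → Y≡X (suc r) _ (off j≢q c c≢))
    = lemma ((-1ℤ ℤ.^ toℕ j) * X zero j) k (det (minor j X)) (det (minor j Y))
    where
    lemma : ∀ s k d e → s * (d + k * e) ≡ s * d + k * (s * e)
    lemma = solve-∀

-- Deleting a column other than p and q keeps two equal neighbours, so those Laplace terms vanish by
-- induction. The terms at p and q have equal entries and equal minors, but opposite signs because
-- the indices differ by one.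
det-equal-adjacent : ∀ {n} {p q : Fin n} (X : Matrix n n) → Adjacent p q →
  (∀ r → X r p ≡ X r q) → det X ≡ 0ℤ
det-equal-adjacent {suc n} {p} {q} X adj eq = sum-adjacent {t = laplaceTerm X} adj off on
  where
  off : ∀ j → j ≢ p → j ≢ q → laplaceTerm X j ≡ 0ℤ
  off j j≢p j≢q = trans (cong ((-1ℤ ℤ.^ toℕ j) * X zero j *_)
    (det-equal-adjacent (minor j X) (adjacent-punchOut j≢p j≢q adj) λ r →
      trans (cong (X (suc r)) (punchIn-punchOut j≢p))
      (trans (eq (suc r)) (cong (X (suc r)) (sym (punchIn-punchOut j≢q))))))
    (*-zeroʳ ((-1ℤ ℤ.^ toℕ j) * X zero j))

  minors : ∀ r c → minor q X r c ≡ minor p X r c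
  minors r c with punchIn-adjacent adj c
  ... | inj₁ e         = cong (X (suc r)) (sym e)
  ... | inj₂ (e₁ , e₂) = trans (cong (X (suc r)) e₂) (trans (eq (suc r)) (cong (X (suc r)) (sym e₁)))

  on : laplaceTerm X p + laplaceTerm X q ≡ 0ℤ
  on rewrite det-cong {A = minor q X} {minor p X} minors | sym (eq zero) | adjacent⇒toℕ adj =
    lemma (-1ℤ ℤ.^ toℕ p) (X zero p) (det (minor p X))
    where
    lemma : ∀ s x d → s * x * d + -1ℤ * s * x * d ≡ 0ℤ
    lemma s x d = trans (cong (λ z → s * x * d + z * x * d) (-1*i≡-i s)) (lemma′ s x d)
      where
      lemma′ : ∀ s x d → s * x * d + - s * x * d ≡ 0ℤ
      lemma′ = solve-∀

-- Elementary column operations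

_~_ : ∀ {n} → Fin n → Fin n → Set
p ~ q = Adjacent p q ⊎ Adjacent q p

~⇒≢ : ∀ {n} {p q : Fin n} → p ~ q → p ≢ q
~⇒≢ (inj₁ a) = adjacent⇒≢ a
~⇒≢ (inj₂ a) = adjacent⇒≢ a ∘ sym

~-sym : ∀ {n} {p q : Fin n} → p ~ q → q ~ p
~-sym (inj₁ a) = inj₂ a
~-sym (inj₂ a) = inj₁ a

shear : ∀ {m n} → Fin n → Fin n → ℤ → Matrix m n → Matrix m n
shear p q k X r = updateAt (X r) q (_+ k * X r p)

shear-at : ∀ {m n} (p q : Fin n) k (X : Matrix m n) r → shear p q k X r q ≡ X r q + k * X r p
shear-at p q k X r = updateAt-updates q (X r)

shear-off : ∀ {m n} (p q : Fin n) k (X : Matrix m n) r c → c ≢ q → shear p q k X r c ≡ X r c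
shear-off p q k X r c c≢q = updateAt-minimal c q (X r) c≢q

-- By linearity in column q the change is k times the determinant of X with column q overwritten by
-- column p, a matrix with two equal neighbouring columns.
det-shear : ∀ {n} {p q : Fin n} k (X : Matrix n n) → p ~ q → det (shear p q k X) ≡ det X
det-shear {p = p} {q} k X p~q = begin
  det (shear p q k X)  ≡⟨ det-linear q k {X} {Y}
                            (λ r → trans (shear-at p q k X r) (cong (λ z → X r q + k * z) (sym (Yq r))))
                            (shear-off p q k X)
                            (λ r c → updateAt-minimal c q (X r)) ⟩
  det X + k * det Y    ≡⟨ cong (λ z → det X + k * z) (Y≡0 p~q) ⟩
  det X + k * 0ℤ       ≡⟨ cong (det X +_) (*-zeroʳ k) ⟩
  det X + 0ℤ           ≡⟨ +-identityʳ (det X) ⟩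
  det X                ∎
  where
  open ≡-Reasoning
  Y : Matrix _ _
  Y r = updateAt (X r) q (λ _ → X r p)
  Yq : ∀ r → Y r q ≡ X r p
  Yq r = updateAt-updates q (X r)
  Yp≡Yq : ∀ r → Y r p ≡ Y r q
  Yp≡Yq r = trans (updateAt-minimal p q (X r) (~⇒≢ p~q)) (sym (Yq r))
  Y≡0 : p ~ q → det Y ≡ 0ℤ
  Y≡0 (inj₁ a) = det-equal-adjacent Y a Yp≡Yq
  Y≡0 (inj₂ a) = det-equal-adjacent Y a (sym ∘ Yp≡Yq)

det-head : ∀ {n} (A : Matrix (suc n) (suc n)) → (∀ c → A zero (suc c) ≡ 0ℤ) →
           det A ≡ A zero zero * det (minor zero A)
det-head A eq = trans
  (sum-head {t = laplaceTerm A} λ j → trans (cong (λ z → (-1ℤ ℤ.^ suc (toℕ j)) * z * det (minor (suc j) A)) (eq j))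
    (trans (cong (_* det (minor (suc j) A)) (*-zeroʳ (-1ℤ ℤ.^ suc (toℕ j)))) (*-zeroˡ (det (minor (suc j) A)))))
  (cong (_* det (minor zero A)) (*-identityˡ (A zero zero)))

infixl 7 _·_
_·_ : ∀ {m n} → Matrix m n → Vector ℤ n → Vector ℤ m
(X · a) r = sum λ c → a c * X r c

-- Linear independence of the columns over ℤ.
Injective : ∀ {m n} → Matrix m n → Set
Injective X = ∀ a → (∀ r → (X · a) r ≡ 0ℤ) → ∀ c → a c ≡ 0ℤ

-- A shear is right multiplication by an elementary matrix; applied to the coefficients instead,
-- that matrix changes entry p by a multiple of entry q. Two uses of `sum-updateAt`, one on the row
-- and one on the coefficients, meet in the middle.
shear-· : ∀ {m n} (p q : Fin n) k (X : Matrix m n) a r →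
  (shear p q k X · a) r ≡ (X · updateAt a p (_+ k * a q)) r
shear-· p q k X a r = begin
  sum (λ c → a c * updateAt (X r) q (_+ k * X r p) c)  ≡⟨ sum-updateAt a (X r) q (k * X r p) ⟩
  sum (λ c → a c * X r c) + a q * (k * X r p)          ≡⟨ cong₂ _+_ (sum-cong-≗ λ c → *-comm (a c) (X r c)) (lemma (a q) k (X r p)) ⟩
  sum (λ c → X r c * a c) + X r p * (k * a q)          ≡⟨ sum-updateAt (X r) a p (k * a q) ⟨
  sum (λ c → X r c * updateAt a p (_+ k * a q) c)      ≡⟨ sum-cong-≗ (λ c → *-comm (X r c) _) ⟩
  (X · updateAt a p (_+ k * a q)) r                    ∎
  where
  open ≡-Reasoning
  lemma : ∀ a k x → a * (k * x) ≡ x * (k * a)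
  lemma = solve-∀

shear-inverse : ∀ {m n} {p q : Fin n} k (X : Matrix m n) → p ≢ q → ∀ r c →
  shear p q (- k) (shear p q k X) r c ≡ X r c
shear-inverse {p = p} {q} k X p≢q r c with c ≟ q
... | no  c≢q  = trans (shear-off p q (- k) (shear p q k X) r c c≢q) (shear-off p q k X r c c≢q)
... | yes refl = begin
  shear p c (- k) (shear p c k X) r c               ≡⟨ shear-at p c (- k) (shear p c k X) r ⟩
  shear p c k X r c + - k * shear p c k X r p       ≡⟨ cong₂ (λ x y → x + - k * y) (shear-at p c k X r) (shear-off p c k X r p p≢q) ⟩
  X r c + k * X r p + - k * X r p                   ≡⟨ lemma (X r c) k (X r p) ⟩
  X r c                                             ∎
  where
  open ≡-Reasoning
  lemma : ∀ x k y → x + k * y + - k * y ≡ x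
  lemma = solve-∀

·-cong : ∀ {m n} {X Y : Matrix m n} → (∀ r c → X r c ≡ Y r c) → ∀ a r → (X · a) r ≡ (Y · a) r
·-cong eq a r = sum-cong-≗ λ c → cong (a c *_) (eq r c)

-- X is the sheared matrix sheared back by - k, so every element of the column lattice of X lies in
-- that of the sheared matrix.
·-shear : ∀ {m n} {p q : Fin n} k (X : Matrix m n) → p ≢ q → ∀ a r →
  (X · a) r ≡ (shear p q k X · updateAt a p (_+ - k * a q)) r
·-shear {p = p} {q} k X p≢q a r =
  trans (·-cong (λ r c → sym (shear-inverse k X p≢q r c)) a r) (shear-· p q (- k) (shear p q k X) a r)

-- Entry q is untouched, hence 0, and then the change made to entry p is 0 as well.
updateAt-zero : ∀ {n} (a : Vector ℤ n) {p q} k → p ≢ q →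
  (∀ c → updateAt a p (_+ k * a q) c ≡ 0ℤ) → ∀ c → a c ≡ 0ℤ
updateAt-zero a {p} {q} k p≢q eq c with c ≟ p
... | no  c≢p  = trans (sym (updateAt-minimal c p a c≢p)) (eq c)
... | yes refl = begin
  a c            ≡⟨ +-identityʳ (a c) ⟨
  a c + 0ℤ       ≡⟨ cong (a c +_) (*-zeroʳ k) ⟨
  a c + k * 0ℤ   ≡⟨ cong (λ z → a c + k * z) aq≡0 ⟨
  a c + k * a q  ≡⟨ updateAt-updates c a ⟨
  updateAt a c (_+ k * a q) c ≡⟨ eq c ⟩
  0ℤ             ∎
  where
  open ≡-Reasoning
  aq≡0 : a q ≡ 0ℤ
  aq≡0 = trans (sym (updateAt-minimal q p a (p≢q ∘ sym))) (eq q)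

injective-unshear : ∀ {m n} {p q : Fin n} k (X : Matrix m n) → p ≢ q →
  Injective (shear p q k X) → Injective X
injective-unshear {p = p} k X p≢q inj a eq = updateAt-zero a (- k) p≢q
  (inj _ λ r → trans (sym (·-shear k X p≢q a r)) (eq r))

injective-shear : ∀ {m n} {p q : Fin n} k (X : Matrix m n) → p ≢ q →
  Injective X → Injective (shear p q k X)
injective-shear k X p≢q inj a eq = updateAt-zero a k p≢q
  (inj _ λ r → trans (sym (shear-· _ _ k X a r)) (eq r))

-- Clearing the first row by the Euclidean algorithm

division-step : ∀ x y → x ≢ 0ℤ → ℤ.∣ x ∣ ≤ ℤ.∣ y ∣ → ∃ λ k → ℤ.∣ y + k * x ∣ ℕ.< ℤ.∣ y ∣
-- With minus the quotient as k, y + k x is the remainder of y by x, smaller than |x| and so than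
-- |y|.
division-step x y x≢0 x≤y = - (y ℤ./ x) , ℕₚ.<-≤-trans
  (subst (ℕ._< ℤ.∣ x ∣) (sym (cong ℤ.∣_∣ remainder)) (n%d<d y x)) x≤y
  where
  instance
    x≠0 : ℤ.NonZero x
    x≠0 = ℤ.≢-nonZero x≢0
  lemma : ∀ r q x → r + q * x + - q * x ≡ r
  lemma = solve-∀
  remainder : y + - (y ℤ./ x) * x ≡ ℤ.+ (y ℤ.% x)
  remainder = trans (cong (_+ - (y ℤ./ x) * x) (a≡a%n+[a/n]*n y x)) (lemma _ (y ℤ./ x) x)

module _ {m n} (P : Matrix (suc m) (suc n) → Set)
  (unshear : ∀ {p q} k X → p ~ q → P (shear p q k X) → P X) where

  private
    -- The Euclidean algorithm on the first-row entries x and y of two neighbouring columns; `fuel`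
    -- exceeds |x| + |y|, which each division decreases. The reduced matrix goes to a continuation,
    -- because `unshear` carries P back from a sheared matrix to the original one.
    clear : ∀ {p q} → p ~ q → ∀ X → (∀ X′ → (∀ c → c ≢ p → c ≢ q → X′ zero c ≡ X zero c) →
            X′ zero q ≡ 0ℤ → P X′) → P X
    clear {p} {q} p~q X = go _ X ℕₚ.≤-refl
      where
      size : Matrix (suc m) (suc n) → ℕ
      size X = ℤ.∣ X zero p ∣ ℕ.+ ℤ.∣ X zero q ∣

      p≢q : p ≢ q
      p≢q = ~⇒≢ p~q

      go : ∀ fuel X → size X ℕ.< fuel →
           (∀ X′ → (∀ c → c ≢ p → c ≢ q → X′ zero c ≡ X zero c) → X′ zero q ≡ 0ℤ → P X′) → P X
      go (suc fuel) X (ℕ.s≤s size≤fuel) done with X zero q ℤₚ.≟ 0ℤ | X zero p ℤₚ.≟ 0ℤ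
      ... | yes y≡0 | _ = done X (λ _ _ _ → refl) y≡0
      -- Two shears move the surviving entry to column p: (0, y) becomes (y, y) and then (y, 0).
      ... | no y≢0 | yes x≡0 =
        unshear 1ℤ X (~-sym p~q) (unshear -1ℤ X₁ p~q
          (done (shear p q -1ℤ X₁)
            (λ c c≢p c≢q → trans (shear-off p q -1ℤ X₁ zero c c≢q) (shear-off q p 1ℤ X zero c c≢p))
            (begin
              shear p q -1ℤ X₁ zero q            ≡⟨ shear-at p q -1ℤ X₁ zero ⟩
              X₁ zero q + -1ℤ * X₁ zero p        ≡⟨ cong₂ (λ y x → y + -1ℤ * x) (shear-off q p 1ℤ X zero q (p≢q ∘ sym)) (shear-at q p 1ℤ X zero) ⟩
              X zero q + -1ℤ * (X zero p + 1ℤ * X zero q) ≡⟨ cong (λ x → X zero q + -1ℤ * (x + 1ℤ * X zero q)) x≡0 ⟩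
              X zero q + -1ℤ * (0ℤ + 1ℤ * X zero q)       ≡⟨ lemma (X zero q) ⟩
              0ℤ                                 ∎)))
        where
        open ≡-Reasoning
        X₁ = shear q p 1ℤ X
        lemma : ∀ y → y + -1ℤ * (0ℤ + 1ℤ * y) ≡ 0ℤ
        lemma y rewrite *-identityˡ y | +-identityˡ y | -1*i≡-i y = +-inverseʳ y
      ... | no y≢0 | no x≢0 with ℕₚ.≤-total ℤ.∣ X zero p ∣ ℤ.∣ X zero q ∣
      ...   | inj₁ x≤y = let k , y′<y = division-step _ (X zero q) x≢0 x≤y in
        unshear k X p~q (go fuel (shear p q k X)
          (ℕₚ.<-≤-trans (subst₂ (λ x y → ℤ.∣ x ∣ ℕ.+ ℤ.∣ y ∣ ℕ.< size X)
              (sym (shear-off p q k X zero p p≢q)) (sym (shear-at p q k X zero))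
              (ℕₚ.+-monoʳ-< ℤ.∣ X zero p ∣ y′<y)) size≤fuel)
          (λ X′ eq → done X′ λ c c≢p c≢q → trans (eq c c≢p c≢q) (shear-off p q k X zero c c≢q)))
      ...   | inj₂ y≤x = let k , x′<x = division-step _ (X zero p) y≢0 y≤x in
        unshear k X (~-sym p~q) (go fuel (shear q p k X)
          (ℕₚ.<-≤-trans (subst₂ (λ x y → ℤ.∣ x ∣ ℕ.+ ℤ.∣ y ∣ ℕ.< size X)
              (sym (shear-at q p k X zero)) (sym (shear-off q p k X zero q (p≢q ∘ sym)))
              (ℕₚ.+-monoˡ-< ℤ.∣ X zero q ∣ x′<x)) size≤fuel)
          (λ X′ eq → done X′ λ c c≢p c≢q → trans (eq c c≢p c≢q) (shear-off q p k X zero c c≢p)))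

  -- As an induction principle this serves kernels, minors and point counts alike: each only has to
  -- be transported along a single shear. Columns are cleared from the right, each against its left
  -- neighbour, and the entries already cleared stay untouched.
  column-reduction : (∀ X → (∀ c → X zero (suc c) ≡ 0ℤ) → P X) → ∀ X → P X
  -- At the last column the hypothesis of `ClearedBeyond` is vacuous.
  column-reduction base X = <-weakInduction ClearedBeyond start step (Fin.fromℕ n) X λ c n<c →
    contradiction (Finₚ.≤fromℕ c) (ℕₚ.<⇒≱ n<c)
    where
    ClearedBeyond : Fin (suc n) → Set
    ClearedBeyond p = ∀ X → (∀ c → p Fin.< c → X zero c ≡ 0ℤ) → P X

    start : ClearedBeyond zero
    start X eq = base X λ c → eq (suc c) (ℕ.s≤s ℕ.z≤n)

    step : ∀ i → ClearedBeyond (inject₁ i) → ClearedBeyond (suc i)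
    step i next X eq = clear (inj₁ (adjacent-inject₁ i)) X λ X′ same X′q≡0 → next X′ λ c i<c →
      case c i<c X′ same X′q≡0
      where
      case : ∀ c → inject₁ i Fin.< c → ∀ X′ →
        (∀ c → c ≢ inject₁ i → c ≢ suc i → X′ zero c ≡ X zero c) → X′ zero (suc i) ≡ 0ℤ → X′ zero c ≡ 0ℤ
      case c i<c X′ same X′q≡0 with c ≟ suc i
      ... | yes refl = X′q≡0
      ... | no  c≢   = trans (same c (λ { refl → ℕₚ.<-irrefl refl i<c }) c≢)
        (eq c (ℕₚ.≤∧≢⇒< (subst (λ z → suc z ≤ toℕ c) (toℕ-inject₁ i) i<c) (c≢ ∘ sym ∘ Finₚ.toℕ-injective)))

-- Maximal minors

row-product : ∀ {m n} (X : Matrix (suc m) (suc n)) → (∀ c → X zero (suc c) ≡ 0ℤ) → ∀ a →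
  (X · a) zero ≡ a zero * X zero zero
row-product X eq a = sum-head {t = λ c → a c * X zero c} λ c →
  trans (cong (a (suc c) *_) (eq c)) (*-zeroʳ (a (suc c)))

tail-product : ∀ {m n} (X : Matrix (suc m) (suc n)) a → a zero ≡ 0ℤ → ∀ r →
  (X · a) (suc r) ≡ (minor zero X · (a ∘ suc)) r
tail-product X a a₀≡0 r = trans
  (cong (λ z → z * X (suc r) zero + rest) a₀≡0)
  (trans (cong (_+ rest) (*-zeroˡ (X (suc r) zero))) (+-identityˡ rest))
  where rest = (minor zero X · (a ∘ suc)) r

-- Once the first row is (d, 0, ..., 0), the determinant is d times the remaining minor and both
-- factors are nonzero. The first row then forces the first coefficient to be 0, and the minor
-- forces the others by induction.
det≢0⇒injective : ∀ {n} (A : Matrix n n) → det A ≢ 0ℤ → Injective A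
det≢0⇒injective {zero}  A _ a _ ()
det≢0⇒injective {suc n} = column-reduction (λ A → det A ≢ 0ℤ → Injective A)
  (λ k A p~q ih d≢0 → injective-unshear k A (~⇒≢ p~q) (ih (d≢0 ∘ trans (sym (det-shear k A p~q)))))
  λ A eq d≢0 a Aa≡0 →
    let d₀≢0 : A zero zero ≢ 0ℤ
        d₀≢0 e = d≢0 (trans (det-head A eq) (trans (cong (_* det (minor zero A)) e) (*-zeroˡ (det (minor zero A)))))
        d′≢0 : det (minor zero A) ≢ 0ℤ
        d′≢0 e = d≢0 (trans (det-head A eq) (trans (cong (A zero zero *_) e) (*-zeroʳ (A zero zero))))
        a₀≡0 = *-cancelʳ-≡0 _ _ d₀≢0 (trans (sym (row-product A eq a)) (Aa≡0 zero))
    in λ { zero    → a₀≡0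
         ; (suc c) → det≢0⇒injective (minor zero A) d′≢0 (a ∘ suc)
                       (λ r → trans (sym (tail-product A a a₀≡0 r)) (Aa≡0 (suc r))) c }
  where
  *-cancelʳ-≡0 : ∀ i j → j ≢ 0ℤ → i * j ≡ 0ℤ → i ≡ 0ℤ
  *-cancelʳ-≡0 i j j≢0 eq with i*j≡0⇒i≡0∨j≡0 i eq
  ... | inj₁ i≡0 = i≡0
  ... | inj₂ j≡0 = contradiction j≡0 j≢0

-- Let the first row be (d, 0, ..., 0). If d = 0, the columns are independent already on the
-- remaining rows, and the first row is left out of I. If d ≠ 0, the other columns are independent
-- on the remaining rows, and adding the first row to I multiplies the minor by d.
nonzero-minor : ∀ {N J} (X : Matrix N J) → Injective X →
  ∃ λ I → I ∈ˡ subsetsOfSize N J × det (rows X I) ≢ 0ℤ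
nonzero-minor {zero}  {zero}  X inj = ([] , refl) , here refl , λ ()
-- Without rows every vector lies in the kernel, in particular the constant 1.
nonzero-minor {zero}  {suc J} X inj = contradiction (inj (λ _ → 1ℤ) (λ ()) zero) λ ()
nonzero-minor {suc N} {zero}  X inj =
  let I , I∈ , _ = nonzero-minor (λ r → X (suc r)) (λ _ _ ()) in
  _ , ∈-map⁺ (λ (I , e) → outside ∷ I , e) I∈ , λ ()
nonzero-minor {suc N} {suc J} = column-reduction HasNonzeroMinor
  (λ k X p~q ih inj → let I , I∈ , d≢0 = ih (injective-shear k X (~⇒≢ p~q) inj) in
    I , I∈ , d≢0 ∘ trans (det-shear k (rows X I) p~q))
  base
  where
  HasNonzeroMinor : Matrix (suc N) (suc J) → Set
  HasNonzeroMinor X = Injective X → ∃ λ I → I ∈ˡ subsetsOfSize (suc N) (suc J) × det (rows X I) ≢ 0ℤ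

  base : ∀ X → (∀ c → X zero (suc c) ≡ 0ℤ) → HasNonzeroMinor X
  base X eq inj with X zero zero ℤₚ.≟ 0ℤ
  ... | yes d≡0 =
    let I , I∈ , D≢0 = nonzero-minor (λ r → X (suc r)) λ a Xa≡0 → inj a λ
          { zero → trans (row-product X eq a) (trans (cong (a zero *_) d≡0) (*-zeroʳ (a zero)))
          ; (suc r) → Xa≡0 r }
    in _ , ∈-++⁺ʳ _ (∈-map⁺ (λ (I , e) → outside ∷ I , e) I∈) , D≢0
  ... | no d≢0 =
    let I , I∈ , D≢0 = nonzero-minor (minor zero X) λ a Xa≡0 c → inj (0ℤ ◂ a)
          (λ { zero → trans (row-product X eq (0ℤ ◂ a)) (*-zeroˡ (X zero zero))
             ; (suc r) → trans (tail-product X (0ℤ ◂ a) refl r) (Xa≡0 r) }) (suc c)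
    in _ , ∈-++⁺ˡ (∈-map⁺ (λ (I , e) → inside ∷ I , cong suc e) I∈) ,
       λ D≡0 → nonzero I D≢0 (trans (sym (det-head (rows X (inside ∷ proj₁ I , cong suc (proj₂ I))) eq)) D≡0)
    where
    nonzero : ∀ I → det (rows (minor zero X) I) ≢ 0ℤ → X zero zero * det (rows (minor zero X) I) ≢ 0ℤ
    nonzero I D≢0 eq with i*j≡0⇒i≡0∨j≡0 (X zero zero) eq
    ... | inj₁ d≡0 = d≢0 d≡0
    ... | inj₂ D≡0 = D≢0 D≡0

maxMinor-attained : ∀ {N J} (X : Matrix N J) → Injective X →
  maxMinor X ≢ 0 × ∃ λ I → ℤ.∣ det (rows X I) ∣ ≡ maxMinor X
maxMinor-attained {N} {J} X inj = positive , attained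
  where
  minors : List ℕ
  minors = List.map (λ I → ℤ.∣ det (rows X I) ∣) (subsetsOfSize N J)

  positive : maxMinor X ≢ 0
  positive max≡0 = let I , I∈ , D≢0 = nonzero-minor X inj in
    D≢0 (∣i∣≡0⇒i≡0 (ℕₚ.n≤0⇒n≡0 (subst (ℤ.∣ det (rows X I) ∣ ≤_) max≡0
      (All.lookup (xs≤max 0 minors) (∈-map⁺ (λ I → ℤ.∣ det (rows X I) ∣) I∈)))))

  attained : ∃ λ I → ℤ.∣ det (rows X I) ∣ ≡ maxMinor X
  attained with argmax-sel (λ n → n) 0 minors
  -- The selected value may still be the default 0; positivity excludes this.
  ... | inj₁ max≡0 = contradiction max≡0 positive
  ... | inj₂ max∈  = let I , _ , eq = ∈-map⁻ _ max∈ in I , sym eq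

-- Counting points of a box

total : ∀ {n N} → (Vec (Fin n) N → ℕ) → ℕ
total {N = zero}  f = f []
total {N = suc N} f = ∑ℕ.sum λ k → total λ v → f (k ∷ v)

total-cong : ∀ {n N} {f g : Vec (Fin n) N → ℕ} → (∀ v → f v ≡ g v) → total f ≡ total g
total-cong {N = zero}  eq = eq []
total-cong {N = suc N} eq = ∑ℕ.sum-cong-≗ λ k → total-cong λ v → eq (k ∷ v)

sum-total : ∀ {m n N} (f : Fin m → Vec (Fin n) N → ℕ) →
  (∑ℕ.sum λ i → total (f i)) ≡ total λ v → ∑ℕ.sum λ i → f i v
sum-total {N = zero}  f = refl
sum-total {N = suc N} f = trans
  (∑ℕ.∑-comm λ i k → total λ v → f i (k ∷ v))
  (∑ℕ.sum-cong-≗ λ k → sum-total λ i v → f i (k ∷ v))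

sum-const : ∀ n k → (∑ℕ.sum {n} λ _ → k) ≡ n ℕ.* k
sum-const zero    k = refl
sum-const (suc n) k = cong (k ℕ.+_) (sum-const n k)

total-one : ∀ n N → total {n} {N} (λ _ → 1) ≡ n ℕ.^ N
total-one n zero    = refl
total-one n (suc N) = trans (sum-const n _) (cong (n ℕ.*_) (total-one n N))

sum-positive : ∀ {n} (t : Vector ℕ n) → 0 ℕ.< ∑ℕ.sum t → ∃ λ i → 0 ℕ.< t i
sum-positive {suc n} t 0<∑ with t zero in eq
... | suc _ = zero , subst (0 ℕ.<_) (sym eq) (ℕ.s≤s ℕ.z≤n)
... | zero  = let i , 0<tᵢ = sum-positive (t ∘ suc) 0<∑ in suc i , 0<tᵢ

total-positive : ∀ {n N} (f : Vec (Fin n) N → ℕ) → 0 ℕ.< total f → ∃ λ v → 0 ℕ.< f v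
total-positive {N = zero}  f 0<f = [] , 0<f
total-positive {N = suc N} f 0<∑ =
  let k , 0<total = sum-positive (λ k → total λ v → f (k ∷ v)) 0<∑
      v , 0<f     = total-positive (λ v → f (k ∷ v)) 0<total
  in k ∷ v , 0<f

-- e counts the initial terms still forced to vanish by the last nonzero one.
sum-spaced′ : ∀ {m} d B (t : Vector ℕ m) e → e ≤ d → (∀ k → t k ≤ B) →
  (∀ k → 0 ℕ.< t k → e ≤ toℕ k) →
  (∀ k l → 0 ℕ.< t k → 0 ℕ.< t l → toℕ k ℕ.< toℕ l → toℕ k ℕ.+ suc d ≤ toℕ l) →
  ∑ℕ.sum t ℕ.* suc d ℕ.+ e ℕ.* B ≤ (m ℕ.+ d) ℕ.* B
sum-spaced′ {zero}  d B t e e≤d t≤B late spaced = ℕₚ.*-monoˡ-≤ B e≤d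
sum-spaced′ {suc m} d B t (suc e) e≤d t≤B late spaced with t zero in eq
... | suc _ = contradiction (late zero (subst (0 ℕ.<_) (sym eq) (ℕ.s≤s ℕ.z≤n))) λ ()
... | zero  = subst (_≤ B ℕ.+ (m ℕ.+ d) ℕ.* B) (lemma (∑ℕ.sum (t ∘ suc) ℕ.* suc d) B (e ℕ.* B))
  (ℕₚ.+-monoʳ-≤ B (sum-spaced′ d B (t ∘ suc) e (ℕₚ.<⇒≤ e≤d) (t≤B ∘ suc)
    (λ k 0<t → ℕ.s≤s⁻¹ (late (suc k) 0<t))
    (λ k l 0<tk 0<tl k<l → ℕ.s≤s⁻¹ (spaced (suc k) (suc l) 0<tk 0<tl (ℕ.s≤s k<l)))))
  where
  lemma : ∀ s B x → B ℕ.+ (s ℕ.+ x) ≡ s ℕ.+ (B ℕ.+ x)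
  lemma = ℕSolver.solve-∀
sum-spaced′ {suc m} d B t zero e≤d t≤B late spaced with t zero in eq
... | zero  = ℕₚ.≤-trans
  (sum-spaced′ d B (t ∘ suc) 0 ℕ.z≤n (t≤B ∘ suc) (λ _ _ → ℕ.z≤n)
    (λ k l 0<tk 0<tl k<l → ℕ.s≤s⁻¹ (spaced (suc k) (suc l) 0<tk 0<tl (ℕ.s≤s k<l))))
  (ℕₚ.m≤n+m ((m ℕ.+ d) ℕ.* B) B)
... | suc t₀ = ℕₚ.+-cancelʳ-≤ (d ℕ.* B) _ _ (begin
  (suc t₀ ℕ.+ s) ℕ.* suc d ℕ.+ 0 ℕ.+ d ℕ.* B      ≡⟨ lemma₁ (suc t₀) s d (d ℕ.* B) ⟩
  suc t₀ ℕ.* suc d ℕ.+ (s ℕ.* suc d ℕ.+ d ℕ.* B)  ≤⟨ ℕₚ.+-mono-≤ (ℕₚ.*-monoˡ-≤ (suc d) (subst (_≤ B) eq (t≤B zero)))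
      (sum-spaced′ d B (t ∘ suc) d ℕₚ.≤-refl (t≤B ∘ suc)
        (λ k 0<t → ℕ.s≤s⁻¹ (spaced zero (suc k) 0<t₀ 0<t (ℕ.s≤s ℕ.z≤n)))
        (λ k l 0<tk 0<tl k<l → ℕ.s≤s⁻¹ (spaced (suc k) (suc l) 0<tk 0<tl (ℕ.s≤s k<l)))) ⟩
  B ℕ.* suc d ℕ.+ (m ℕ.+ d) ℕ.* B                 ≡⟨ lemma₂ B d m ⟩
  B ℕ.+ (m ℕ.+ d) ℕ.* B ℕ.+ d ℕ.* B               ∎)
  where
  open ℕₚ.≤-Reasoning
  s = ∑ℕ.sum (t ∘ suc)
  0<t₀ : 0 ℕ.< t zero
  0<t₀ = subst (0 ℕ.<_) (sym eq) (ℕ.s≤s ℕ.z≤n)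
  lemma₁ : ∀ t s d x → (t ℕ.+ s) ℕ.* suc d ℕ.+ 0 ℕ.+ x ≡ t ℕ.* suc d ℕ.+ (s ℕ.* suc d ℕ.+ x)
  lemma₁ = ℕSolver.solve-∀
  lemma₂ : ∀ B d m → B ℕ.* suc d ℕ.+ (m ℕ.+ d) ℕ.* B ≡ B ℕ.+ (m ℕ.+ d) ℕ.* B ℕ.+ d ℕ.* B
  lemma₂ = ℕSolver.solve-∀

-- Positions at least d apart among w + 1 places number at most w/d + 1, and each contributes at
-- most B; the bound is stated multiplied by d. No initial term is forced to vanish, so e = 0.
sum-spaced : ∀ {w} d B (t : Vector ℕ (suc w)) → d ≢ 0 → (∀ k → t k ≤ B) →
  (∀ k l → 0 ℕ.< t k → 0 ℕ.< t l → toℕ k ℕ.< toℕ l → toℕ k ℕ.+ d ≤ toℕ l) →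
  ∑ℕ.sum t ℕ.* d ≤ (w ℕ.+ d) ℕ.* B
sum-spaced zero    B t d≢0 t≤B spaced = contradiction refl d≢0
sum-spaced {w} (suc d) B t d≢0 t≤B spaced = begin
  ∑ℕ.sum t ℕ.* suc d             ≡⟨ ℕₚ.+-identityʳ _ ⟨
  ∑ℕ.sum t ℕ.* suc d ℕ.+ 0       ≤⟨ sum-spaced′ d B t 0 ℕ.z≤n t≤B (λ _ _ → ℕ.z≤n) spaced ⟩
  (suc w ℕ.+ d) ℕ.* B            ≡⟨ cong (ℕ._* B) (ℕₚ.+-suc w d) ⟨
  (w ℕ.+ suc d) ℕ.* B            ∎
  where open ℕₚ.≤-Reasoning

-- At most one term is nonzero, so any spacing may be claimed. On n + 1 places the spacing n + 1
-- gives (n + 1) ∑ ≤ 2n + 1, hence ∑ < 2.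
sum-≤1 : ∀ {n} (t : Vector ℕ n) → (∀ k → t k ≤ 1) →
  (∀ k l → 0 ℕ.< t k → 0 ℕ.< t l → k ≡ l) → ∑ℕ.sum t ≤ 1
sum-≤1 {zero}  t t≤1 unique = ℕ.z≤n
sum-≤1 {suc n} t t≤1 unique = ℕ.s≤s⁻¹ (ℕₚ.*-cancelʳ-< (suc n) (∑ℕ.sum t) 2 (begin-strict
  ∑ℕ.sum t ℕ.* suc n      ≤⟨ sum-spaced (suc n) 1 t (λ ()) t≤1
                               (λ k l 0<tk 0<tl k<l → contradiction (cong toℕ (unique k l 0<tk 0<tl)) (ℕₚ.<⇒≢ k<l)) ⟩
  (n ℕ.+ suc n) ℕ.* 1     ≡⟨ ℕₚ.*-identityʳ _ ⟩
  n ℕ.+ suc n             <⟨ ℕₚ.≤-refl ⟩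
  suc n ℕ.+ suc n         ≡⟨ cong (suc n ℕ.+_) (ℕₚ.+-identityʳ (suc n)) ⟨
  2 ℕ.* suc n             ∎))
  where open ℕₚ.≤-Reasoning

-- Congruence of pairs replaces membership, because a slice or a translate of lattice points only
-- lies in a coset.
_≡_mod_ : ∀ {n N J} → Vec (Fin n) N → Vec (Fin n) N → Matrix N J → Set
u ≡ v mod X = ∃ λ a → ∀ r → ℤ.+ toℕ (lookup u r) - ℤ.+ toℕ (lookup v r) ≡ (X · a) r

-- Since k < l, the multiplier i is nonzero, so the difference is at least |d|.
congruent⇒apart : ∀ (k l : ℕ) i d → k ℕ.< l → ℤ.+ l - ℤ.+ k ≡ i * d → k ℕ.+ ℤ.∣ d ∣ ≤ l
congruent⇒apart k l i d k<l eq = begin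
  k ℕ.+ ℤ.∣ d ∣                    ≤⟨ ℕₚ.+-monoʳ-≤ k (ℕₚ.m≤n*m ℤ.∣ d ∣ ℤ.∣ i ∣ {{ℕ.≢-nonZero ∣i∣≢0}}) ⟩
  k ℕ.+ ℤ.∣ i ∣ ℕ.* ℤ.∣ d ∣        ≡⟨ cong (k ℕ.+_) gap ⟨
  k ℕ.+ (l ℕ.∸ k)                  ≡⟨ ℕₚ.m+[n∸m]≡n (ℕₚ.<⇒≤ k<l) ⟩
  l                                ∎
  where
  open ℕₚ.≤-Reasoning
  gap : l ℕ.∸ k ≡ ℤ.∣ i ∣ ℕ.* ℤ.∣ d ∣
  gap = trans (cong ℤ.∣_∣ (trans (sym (ℤₚ.⊖-≥ (ℕₚ.<⇒≤ k<l))) (trans (sym (ℤₚ.m-n≡m⊖n l k)) eq))) (ℤₚ.abs-* i d)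
  ∣i∣≢0 : ℤ.∣ i ∣ ≢ 0
  ∣i∣≢0 ∣i∣≡0 = ℕₚ.m>n⇒m∸n≢0 k<l (trans gap (cong (ℕ._* ℤ.∣ d ∣) ∣i∣≡0))

-- With x , y the factors of the determinant: (w/x + 1)(w/y + 1) ≤ (w/xy + 1)(w + 1).
merge-bounds : ∀ w x y → x ≢ 0 → y ≢ 0 → (w ℕ.+ x) ℕ.* (w ℕ.+ y) ≤ (w ℕ.+ x ℕ.* y) ℕ.* suc w
merge-bounds w zero    y       x≢0 y≢0 = contradiction refl x≢0
merge-bounds w (suc x) zero    x≢0 y≢0 = contradiction refl y≢0
merge-bounds w (suc x) (suc y) x≢0 y≢0 = ℕₚ.≤-trans (ℕₚ.m≤m+n _ (w ℕ.* x ℕ.* y)) (ℕₚ.≤-reflexive (lemma w x y))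
  where
  lemma : ∀ w x y → (w ℕ.+ suc x) ℕ.* (w ℕ.+ suc y) ℕ.+ w ℕ.* x ℕ.* y ≡ (w ℕ.+ suc x ℕ.* suc y) ℕ.* suc w
  lemma = ℕSolver.solve-∀

-- Here f is the indicator of a set of box points, and the inequality is total f ≤ (w/D + 1)
-- n^(J-1), n = w + 1, cleared of denominators. In this form it makes sense for D = 0 and J = 0 too.
CountBound : ∀ {N J} → ℕ → Matrix N J → SubsetOfSize N J → Set
CountBound {N} {J} w X I = (f : Vec (Fin (suc w)) N → ℕ) → (∀ v → f v ≤ 1) →
  (∀ u v → 0 ℕ.< f u → 0 ℕ.< f v → u ≡ v mod X) →
  let D = ℤ.∣ det (rows X I) ∣ in
  total f ℕ.* (D ℕ.* suc w) ≤ (w ℕ.+ D) ℕ.* suc w ℕ.^ J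

count-bound : ∀ w {N J} (X : Matrix N J) I → CountBound w X I
count-bound w {zero} {zero} X ([] , e) f f≤1 _ = begin
  f [] ℕ.* (1 ℕ.* suc w)   ≡⟨ cong (f [] ℕ.*_) (ℕₚ.*-identityˡ (suc w)) ⟩
  f [] ℕ.* suc w           ≤⟨ ℕₚ.*-monoˡ-≤ (suc w) (f≤1 []) ⟩
  1 ℕ.* suc w              ≡⟨ lemma w ⟩
  (w ℕ.+ 1) ℕ.* 1          ∎
  where
  open ℕₚ.≤-Reasoning
  lemma : ∀ w → 1 ℕ.* suc w ≡ (w ℕ.+ 1) ℕ.* 1
  lemma = ℕSolver.solve-∀
-- A coordinate outside I is projected away. For D ≠ 0 the projection is injective on the set, so
-- the fibre sums f′ are again an indicator with the same total.
count-bound w {suc N} {J} X (outside ∷ I , e) f f≤1 congruent with det (rows X (outside ∷ I , e)) ℤₚ.≟ 0ℤ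
... | yes D≡0 rewrite D≡0 = ℕₚ.≤-trans (ℕₚ.≤-reflexive (ℕₚ.*-zeroʳ (total f))) ℕ.z≤n
... | no  D≢0 = subst (λ s → s ℕ.* (D ℕ.* suc w) ≤ (w ℕ.+ D) ℕ.* suc w ℕ.^ J)
    (sym (sum-total λ k v → f (k ∷ v)))
    (count-bound w (λ r → X (suc r)) (I , e) f′
      (λ v → sum-≤1 (λ k → f (k ∷ v)) (λ k → f≤1 (k ∷ v)) (unique v))
      λ u v 0<f′u 0<f′v →
        let k , 0<fu = sum-positive (λ k → f (k ∷ u)) 0<f′u
            l , 0<fv = sum-positive (λ k → f (k ∷ v)) 0<f′v
            a , eq   = congruent (k ∷ u) (l ∷ v) 0<fu 0<fv
        in a , λ r → eq (suc r))
  where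
  D : ℕ
  D = ℤ.∣ det (rows X (outside ∷ I , e)) ∣
  f′ : Vec (Fin (suc w)) N → ℕ
  f′ v = ∑ℕ.sum λ k → f (k ∷ v)
  -- The difference of two points in one fibre vanishes on the rows of I; as D ≠ 0, its coefficients
  -- are 0, and with them its first coordinate.
  unique : ∀ v k l → 0 ℕ.< f (k ∷ v) → 0 ℕ.< f (l ∷ v) → k ≡ l
  unique v k l 0<fk 0<fl =
    let a , eq = congruent (k ∷ v) (l ∷ v) 0<fk 0<fl
        a≡0 = det≢0⇒injective (rows X (outside ∷ I , e)) D≢0 a λ r →
          trans (sym (eq (suc (member I (Fin.cast (sym e) r))))) (ℤₚ.+-inverseʳ (ℤ.+ toℕ (lookup v _)))
    in Finₚ.toℕ-injective (ℤₚ.+-injective (ℤₚ.i-j≡0⇒i≡j _ _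
         (trans (eq zero) (sum-zero λ c → trans (cong (_* X zero c) (a≡0 c)) (ℤₚ.*-zeroˡ (X zero c))))))
-- A shear keeps the determinant and carries congruences over, so the first row may be taken as (d,
-- 0, ..., 0).
count-bound w {suc N} {suc J} X (inside ∷ I , e) = column-reduction
  (λ X → CountBound w X (inside ∷ I , e))
  (λ {p} {q} k X p~q bound f f≤1 congruent →
    subst (λ D → total f ℕ.* (ℤ.∣ D ∣ ℕ.* suc w) ≤ (w ℕ.+ ℤ.∣ D ∣) ℕ.* suc w ℕ.^ suc J)
      (det-shear k (rows X (inside ∷ I , e)) p~q)
      (bound f f≤1 λ u v 0<fu 0<fv → let a , eq = congruent u v 0<fu 0<fv in
        updateAt a p (_+ - k * a q) , λ r → trans (eq r) (·-shear k X (~⇒≢ p~q) a r)))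
  base X
  where
  base : ∀ X → (∀ c → X zero (suc c) ≡ 0ℤ) → CountBound w X (inside ∷ I , e)
  base X eq f f≤1 congruent = subst
    (λ D → total f ℕ.* (D ℕ.* suc w) ≤ (w ℕ.+ D) ℕ.* suc w ℕ.^ suc J)
    (sym (trans (cong ℤ.∣_∣ (det-head (rows X (inside ∷ I , e)) eq)) (ℤₚ.abs-* (X zero zero) (det (rows (minor zero X) I′)))))
    product-bound
    where
    open ℕₚ.≤-Reasoning
    I′ : SubsetOfSize N J
    I′ = I , cong ℕ.pred e
    d D′ n B : ℕ
    d  = ℤ.∣ X zero zero ∣
    D′ = ℤ.∣ det (rows (minor zero X) I′) ∣
    n  = suc w
    B  = (w ℕ.+ D′) ℕ.* n ℕ.^ J
    slice : Fin n → ℕ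
    slice k = total λ v → f (k ∷ v)

    slice-point : ∀ k → 0 ℕ.< slice k ℕ.* (D′ ℕ.* n) → ∃ λ v → 0 ℕ.< f (k ∷ v)
    slice-point k 0<t = total-positive (λ v → f (k ∷ v))
      (ℕₚ.n≢0⇒n>0 λ s≡0 → ℕₚ.<⇒≢ 0<t (sym (cong (ℕ._* (D′ ℕ.* n)) s≡0)))

    -- Two points of one slice have a₀ d = 0, so a₀ = 0 and their difference involves the remaining
    -- columns only.
    slice-bound : d ≢ 0 → ∀ k → slice k ℕ.* (D′ ℕ.* n) ≤ B
    slice-bound d≢0 k = count-bound w (minor zero X) I′ (λ v → f (k ∷ v)) (λ v → f≤1 (k ∷ v))
      λ u v 0<fu 0<fv →
        let a , same = congruent (k ∷ u) (k ∷ v) 0<fu 0<fv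
            a₀d≡0 = trans (sym (row-product X eq a)) (trans (sym (same zero)) (ℤₚ.+-inverseʳ (ℤ.+ toℕ k)))
        in a ∘ suc , λ r → trans (same (suc r)) (tail-product X a (a₀≡0 (a zero) a₀d≡0) r)
      where
      a₀≡0 : ∀ a₀ → a₀ * X zero zero ≡ 0ℤ → a₀ ≡ 0ℤ
      a₀≡0 a₀ eq with ℤₚ.i*j≡0⇒i≡0∨j≡0 a₀ eq
      ... | inj₁ a₀≡0 = a₀≡0
      ... | inj₂ d≡0  = contradiction (cong ℤ.∣_∣ d≡0) d≢0

    -- The first coordinates of congruent points differ by a multiple of d.
    slices-spaced : ∀ k l → 0 ℕ.< slice k ℕ.* (D′ ℕ.* n) → 0 ℕ.< slice l ℕ.* (D′ ℕ.* n) →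
      toℕ k ℕ.< toℕ l → toℕ k ℕ.+ d ≤ toℕ l
    slices-spaced k l 0<tk 0<tl k<l =
      let u , 0<fu = slice-point k 0<tk
          v , 0<fv = slice-point l 0<tl
          a , same = congruent (l ∷ v) (k ∷ u) 0<fv 0<fu
      in congruent⇒apart (toℕ k) (toℕ l) (a zero) (X zero zero) k<l
           (trans (same zero) (row-product X eq a))

    degenerate : d ℕ.* D′ ≡ 0 → total f ℕ.* (d ℕ.* D′ ℕ.* n) ≤ (w ℕ.+ d ℕ.* D′) ℕ.* n ℕ.^ suc J
    degenerate dD≡0 = ℕₚ.≤-trans (ℕₚ.≤-reflexive
      (trans (cong (λ D → total f ℕ.* (D ℕ.* n)) dD≡0) (ℕₚ.*-zeroʳ (total f)))) ℕ.z≤n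

    product-bound : total f ℕ.* (d ℕ.* D′ ℕ.* n) ≤ (w ℕ.+ d ℕ.* D′) ℕ.* n ℕ.^ suc J
    product-bound with d ℕₚ.≟ 0 | D′ ℕₚ.≟ 0
    ... | yes d≡0 | _ = degenerate (cong (ℕ._* D′) d≡0)
    ... | no _ | yes D≡0 = degenerate (trans (cong (d ℕ.*_) D≡0) (ℕₚ.*-zeroʳ d))
    -- The factor D′ n is moved into each slice count, so that the terms are bounded by B without
    -- division. `merge-bounds` then trades the product of the two bounds for one with d D′ and a
    -- further factor n.
    ... | no d≢0 | no D≢0 = begin
      total f ℕ.* (d ℕ.* D′ ℕ.* n)                     ≡⟨ lemma (total f) d D′ n ⟩
      total f ℕ.* (D′ ℕ.* n) ℕ.* d                     ≡⟨ cong (ℕ._* d) (∑ℕ.*-distribʳ-sum (D′ ℕ.* n) slice) ⟩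
      ∑ℕ.sum (λ k → slice k ℕ.* (D′ ℕ.* n)) ℕ.* d      ≤⟨ sum-spaced d B _ d≢0 (slice-bound d≢0) slices-spaced ⟩
      (w ℕ.+ d) ℕ.* ((w ℕ.+ D′) ℕ.* n ℕ.^ J)           ≡⟨ ℕₚ.*-assoc (w ℕ.+ d) (w ℕ.+ D′) (n ℕ.^ J) ⟨
      (w ℕ.+ d) ℕ.* (w ℕ.+ D′) ℕ.* n ℕ.^ J             ≤⟨ ℕₚ.*-monoˡ-≤ (n ℕ.^ J) (merge-bounds w d D′ d≢0 D≢0) ⟩
      (w ℕ.+ d ℕ.* D′) ℕ.* n ℕ.* n ℕ.^ J               ≡⟨ ℕₚ.*-assoc (w ℕ.+ d ℕ.* D′) n (n ℕ.^ J) ⟩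
      (w ℕ.+ d ℕ.* D′) ℕ.* n ℕ.^ suc J                 ∎
      where
      lemma : ∀ t d D n → t ℕ.* (d ℕ.* D ℕ.* n) ≡ t ℕ.* (D ℕ.* n) ℕ.* d
      lemma = ℕSolver.solve-∀

-- Rational arithmetic

fromℚᵘ-homo-+ : ∀ x y → fromℚᵘ (x ℚᵘ.+ y) ≡ fromℚᵘ x ℚ.+ fromℚᵘ y
fromℚᵘ-homo-+ x y = ℚₚ.toℚᵘ-injective (ℚᵘₚ.≃-trans (ℚₚ.toℚᵘ-fromℚᵘ (x ℚᵘ.+ y))
  (ℚᵘₚ.≃-sym (ℚᵘₚ.≃-trans (ℚₚ.toℚᵘ-homo-+ (fromℚᵘ x) (fromℚᵘ y))
    (ℚᵘₚ.+-cong (ℚₚ.toℚᵘ-fromℚᵘ x) (ℚₚ.toℚᵘ-fromℚᵘ y)))))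

fromℚᵘ-homo-* : ∀ x y → fromℚᵘ (x ℚᵘ.* y) ≡ fromℚᵘ x ℚ.* fromℚᵘ y
fromℚᵘ-homo-* x y = ℚₚ.toℚᵘ-injective (ℚᵘₚ.≃-trans (ℚₚ.toℚᵘ-fromℚᵘ (x ℚᵘ.* y))
  (ℚᵘₚ.≃-sym (ℚᵘₚ.≃-trans (ℚₚ.toℚᵘ-homo-* (fromℚᵘ x) (fromℚᵘ y))
    (ℚᵘₚ.*-cong (ℚₚ.toℚᵘ-fromℚᵘ x) (ℚₚ.toℚᵘ-fromℚᵘ y)))))

fromℚᵘ-mono-≤ : ∀ {x y} → x ℚᵘ.≤ y → fromℚᵘ x ℚ.≤ fromℚᵘ y
fromℚᵘ-mono-≤ {x} {y} x≤y = ℚₚ.toℚᵘ-cancel-≤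
  (ℚᵘₚ.≤-respˡ-≃ (ℚᵘₚ.≃-sym (ℚₚ.toℚᵘ-fromℚᵘ x)) (ℚᵘₚ.≤-respʳ-≃ (ℚᵘₚ.≃-sym (ℚₚ.toℚᵘ-fromℚᵘ y)) x≤y))

-- An unreduced fraction, on which identities can be checked between integers before normalisation.
fromℕᵘ : ℕ → ℚᵘ
fromℕᵘ n = mkℚᵘ (ℤ.+ n) 0

fromℕ-+ : ∀ m n → fromℕ (m ℕ.+ n) ≡ fromℕ m ℚ.+ fromℕ n
fromℕ-+ m n = trans (ℚₚ.fromℚᵘ-cong {fromℕᵘ (m ℕ.+ n)} {fromℕᵘ m ℚᵘ.+ fromℕᵘ n} (ℚᵘ.*≡* (lemma (ℤ.+ m) (ℤ.+ n))))
  (fromℚᵘ-homo-+ (fromℕᵘ m) (fromℕᵘ n))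
  where
  lemma : ∀ m n → (m ℤ.+ n) ℤ.* 1ℤ ≡ (m ℤ.* 1ℤ ℤ.+ n ℤ.* 1ℤ) ℤ.* 1ℤ
  lemma m n = sym (cong (ℤ._* 1ℤ) (cong₂ ℤ._+_ (ℤₚ.*-identityʳ m) (ℤₚ.*-identityʳ n)))

fromℕ-* : ∀ m n → fromℕ (m ℕ.* n) ≡ fromℕ m ℚ.* fromℕ n
fromℕ-* m n = trans (ℚₚ.fromℚᵘ-cong {fromℕᵘ (m ℕ.* n)} {fromℕᵘ m ℚᵘ.* fromℕᵘ n} (ℚᵘ.*≡* (cong (ℤ._* 1ℤ) (ℤₚ.pos-* m n))))
  (fromℚᵘ-homo-* (fromℕᵘ m) (fromℕᵘ n))

fromℕ-mono-≤ : ∀ {m n} → m ≤ n → fromℕ m ℚ.≤ fromℕ n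
fromℕ-mono-≤ {m} {n} m≤n = fromℚᵘ-mono-≤ {fromℕᵘ m} {fromℕᵘ n} (ℚᵘ.*≤* (ℤₚ.*-monoʳ-≤-nonNeg 1ℤ (ℤ.+≤+ m≤n)))

0≤fromℕ : ∀ n → 0ℚ ℚ.≤ fromℕ n
0≤fromℕ n = fromℕ-mono-≤ {0} {n} ℕ.z≤n

0≤reciprocal : ∀ n → 0ℚ ℚ.≤ reciprocal n
0≤reciprocal zero    = ℚₚ.≤-refl
0≤reciprocal (suc n) = ℚₚ.nonNegative⁻¹ (reciprocal (suc n)) {{ℚₚ.normalize-nonNeg 1 (suc n)}}

*-reciprocal : ∀ n → n ≢ 0 → fromℕ n ℚ.* reciprocal n ≡ 1ℚ
*-reciprocal zero    n≢0 = contradiction refl n≢0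
*-reciprocal (suc n) n≢0 = trans (sym (fromℚᵘ-homo-* (fromℕᵘ (suc n)) (mkℚᵘ (ℤ.+ 1) n)))
  (ℚₚ.fromℚᵘ-cong {fromℕᵘ (suc n) ℚᵘ.* mkℚᵘ (ℤ.+ 1) n} {fromℕᵘ 1} (ℚᵘ.*≡* (cong ℤ.+_ (lemma n))))
  where
  lemma : ∀ n → suc n ℕ.* 1 ℕ.* 1 ≡ 1 ℕ.* (1 ℕ.* suc n)
  lemma = ℕSolver.solve-∀

0≤sum : ∀ {n} (t : Vector ℚ n) → (∀ i → 0ℚ ℚ.≤ t i) → 0ℚ ℚ.≤ ∑ℚ.sum t
0≤sum {zero}  t 0≤t = ℚₚ.≤-refl
0≤sum {suc n} t 0≤t = ℚₚ.+-mono-≤ (0≤t zero) (0≤sum (t ∘ suc) (0≤t ∘ suc))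

-- Division of the inequality of `CountBound` by H: both sides are multiplied by ρ = 1/H, and H ρ =
-- 1 is used on each.
divide-bound : ∀ c H w n P → H ≢ 0 → c ℕ.* (H ℕ.* n) ≤ (w ℕ.+ H) ℕ.* P →
  fromℕ (c ℕ.* n) ℚ.≤ (fromℕ w ℚ.* reciprocal H ℚ.+ 1ℚ) ℚ.* fromℕ P
divide-bound c H w n P H≢0 bound = begin
  fromℕ (c ℕ.* n)                                ≡⟨ ℚₚ.*-identityˡ (fromℕ (c ℕ.* n)) ⟨
  1ℚ ℚ.* fromℕ (c ℕ.* n)                         ≡⟨ cong (ℚ._* fromℕ (c ℕ.* n)) (*-reciprocal H H≢0) ⟨
  fromℕ H ℚ.* ρ ℚ.* fromℕ (c ℕ.* n)              ≡⟨ solve 3 (λ h ρ z → h :* ρ :* z := h :* z :* ρ) refl (fromℕ H) ρ (fromℕ (c ℕ.* n)) ⟩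
  fromℕ H ℚ.* fromℕ (c ℕ.* n) ℚ.* ρ              ≡⟨ cong (ℚ._* ρ) (fromℕ-* H (c ℕ.* n)) ⟨
  fromℕ (H ℕ.* (c ℕ.* n)) ℚ.* ρ                  ≡⟨ cong (λ z → fromℕ z ℚ.* ρ) (lemma H c n) ⟩
  fromℕ (c ℕ.* (H ℕ.* n)) ℚ.* ρ                  ≤⟨ ℚₚ.*-monoʳ-≤-nonNeg ρ {{ℚ.nonNegative (0≤reciprocal H)}} (fromℕ-mono-≤ bound) ⟩
  fromℕ ((w ℕ.+ H) ℕ.* P) ℚ.* ρ                  ≡⟨ cong (ℚ._* ρ) (trans (fromℕ-* (w ℕ.+ H) P) (cong (ℚ._* fromℕ P) (fromℕ-+ w H))) ⟩
  (fromℕ w ℚ.+ fromℕ H) ℚ.* fromℕ P ℚ.* ρ        ≡⟨ solve 4 (λ w h p ρ → (w :+ h) :* p :* ρ := (w :* ρ :+ h :* ρ) :* p) refl (fromℕ w) (fromℕ H) (fromℕ P) ρ ⟩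
  (fromℕ w ℚ.* ρ ℚ.+ fromℕ H ℚ.* ρ) ℚ.* fromℕ P  ≡⟨ cong (λ z → (fromℕ w ℚ.* ρ ℚ.+ z) ℚ.* fromℕ P) (*-reciprocal H H≢0) ⟩
  (fromℕ w ℚ.* ρ ℚ.+ 1ℚ) ℚ.* fromℕ P             ∎
  where
  open ℚₚ.≤-Reasoning
  open ℚSolver.+-*-Solver
  ρ = reciprocal H
  lemma : ∀ H c n → H ℕ.* (c ℕ.* n) ≡ c ℕ.* (H ℕ.* n)
  lemma = ℕSolver.solve-∀

-- The summands 1 of the single bounds add up to the term M.
sum-divide-bounds : ∀ {M} (c H : Vector ℕ M) w n P → (∀ i → H i ≢ 0) →
  (∀ i → c i ℕ.* (H i ℕ.* n) ≤ (w ℕ.+ H i) ℕ.* P) →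
  fromℕ (∑ℕ.sum c ℕ.* n) ℚ.≤ (fromℕ w ℚ.* ∑ℚ.sum (λ i → reciprocal (H i)) ℚ.+ fromℕ M) ℚ.* fromℕ P
sum-divide-bounds {zero} c H w n P H≢0 bound = ℚₚ.≤-reflexive (sym
  (solve 2 (λ w p → (w :* con 0ℚ :+ con 0ℚ) :* p := con 0ℚ) refl (fromℕ w) (fromℕ P)))
  where open ℚSolver.+-*-Solver
sum-divide-bounds {suc M} c H w n P H≢0 bound = begin
  fromℕ ((c zero ℕ.+ ∑ℕ.sum (c ∘ suc)) ℕ.* n)                     ≡⟨ cong fromℕ (ℕₚ.*-distribʳ-+ n (c zero) (∑ℕ.sum (c ∘ suc))) ⟩
  fromℕ (c zero ℕ.* n ℕ.+ ∑ℕ.sum (c ∘ suc) ℕ.* n)                 ≡⟨ fromℕ-+ (c zero ℕ.* n) _ ⟩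
  fromℕ (c zero ℕ.* n) ℚ.+ fromℕ (∑ℕ.sum (c ∘ suc) ℕ.* n)         ≤⟨ ℚₚ.+-mono-≤ (divide-bound (c zero) (H zero) w n P (H≢0 zero) (bound zero))
                                                                      (sum-divide-bounds (c ∘ suc) (H ∘ suc) w n P (H≢0 ∘ suc) (bound ∘ suc)) ⟩
  (W ℚ.* ρ ℚ.+ 1ℚ) ℚ.* fromℕ P ℚ.+ (W ℚ.* σ ℚ.+ fromℕ M) ℚ.* fromℕ P
    ≡⟨ solve 5 (λ w ρ σ m p → (w :* ρ :+ con 1ℚ) :* p :+ (w :* σ :+ m) :* p := (w :* (ρ :+ σ) :+ (con 1ℚ :+ m)) :* p)
         refl W ρ σ (fromℕ M) (fromℕ P) ⟩
  (W ℚ.* (ρ ℚ.+ σ) ℚ.+ (1ℚ ℚ.+ fromℕ M)) ℚ.* fromℕ P               ≡⟨ cong (λ z → (W ℚ.* (ρ ℚ.+ σ) ℚ.+ z) ℚ.* fromℕ P) (fromℕ-+ 1 M) ⟨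
  (W ℚ.* (ρ ℚ.+ σ) ℚ.+ fromℕ (suc M)) ℚ.* fromℕ P                  ∎
  where
  open ℚₚ.≤-Reasoning
  open ℚSolver.+-*-Solver
  W = fromℕ w
  ρ = reciprocal (H zero)
  σ = ∑ℚ.sum λ i → reciprocal (H (suc i))

-- Since 0 ≤ ρ ≤ R - s ≤ R gives s ≤ R, 2Rρ + M would be less than 2R² + R².
sqrt-bound : ∀ R M ρ s → 0ℚ ℚ.≤ ρ →
  fromℕ (suc (2 ℕ.* R) ℕ.* suc (2 ℕ.* R)) ℚ.≤ fromℕ (2 ℕ.* R) ℚ.* ρ ℚ.+ fromℕ M →
  0ℚ ℚ.< s → fromℕ M ℚ.< s ℚ.* s → fromℕ R ℚ.- s ℚ.< ρ
sqrt-bound R M ρ s 0≤ρ bound 0<s M<s² with fromℕ R ℚ.- s ℚₚ.<? ρ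
... | yes r-s<ρ = r-s<ρ
... | no  r-s≮ρ = contradiction (begin-strict
  fromℕ (suc (2 ℕ.* R) ℕ.* suc (2 ℕ.* R))      ≤⟨ bound ⟩
  fromℕ (2 ℕ.* R) ℚ.* ρ ℚ.+ fromℕ M            <⟨ ℚₚ.+-mono-≤-< (ℚₚ.*-monoˡ-≤-nonNeg (fromℕ (2 ℕ.* R)) {{ℚ.nonNegative (0≤fromℕ (2 ℕ.* R))}} ρ≤r) M<s² ⟩
  fromℕ (2 ℕ.* R) ℚ.* r ℚ.+ s ℚ.* s            ≤⟨ ℚₚ.+-monoʳ-≤ (fromℕ (2 ℕ.* R) ℚ.* r) (ℚₚ.≤-trans
                                                    (ℚₚ.*-monoˡ-≤-nonNeg s {{ℚ.nonNegative (ℚₚ.<⇒≤ 0<s)}} s≤r)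
                                                    (ℚₚ.*-monoʳ-≤-nonNeg r {{ℚ.nonNegative (0≤fromℕ R)}} s≤r)) ⟩
  fromℕ (2 ℕ.* R) ℚ.* r ℚ.+ r ℚ.* r            ≡⟨ cong₂ ℚ._+_ (fromℕ-* (2 ℕ.* R) R) (fromℕ-* R R) ⟨
  fromℕ (2 ℕ.* R ℕ.* R) ℚ.+ fromℕ (R ℕ.* R)    ≡⟨ fromℕ-+ (2 ℕ.* R ℕ.* R) (R ℕ.* R) ⟨
  fromℕ (2 ℕ.* R ℕ.* R ℕ.+ R ℕ.* R)            ≤⟨ fromℕ-mono-≤ (subst (2 ℕ.* R ℕ.* R ℕ.+ R ℕ.* R ≤_) (square R) (ℕₚ.m≤m+n _ _)) ⟩
  fromℕ (suc (2 ℕ.* R) ℕ.* suc (2 ℕ.* R))      ∎) (ℚₚ.<-irrefl refl)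
  where
  open ℚₚ.≤-Reasoning
  open ℚSolver.+-*-Solver
  r = fromℕ R
  ρ≤r-s : ρ ℚ.≤ r ℚ.- s
  ρ≤r-s = ℚₚ.≮⇒≥ r-s≮ρ
  cancel : ∀ x → x ℚ.- s ℚ.+ s ≡ x
  cancel x = solve 2 (λ x s → x :- s :+ s := x) refl x s
  s≤r : s ℚ.≤ r
  s≤r = subst₂ ℚ._≤_ (ℚₚ.+-identityˡ s) (cancel r) (ℚₚ.+-monoˡ-≤ s (ℚₚ.≤-trans 0≤ρ ρ≤r-s))
  ρ≤r : ρ ℚ.≤ r
  ρ≤r = ℚₚ.≤-trans ρ≤r-s (subst₂ ℚ._≤_ (ℚₚ.+-identityʳ (r ℚ.- s)) (cancel r) (ℚₚ.+-monoʳ-≤ (r ℚ.- s) (ℚₚ.<⇒≤ 0<s)))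
  square : ∀ R → 2 ℕ.* R ℕ.* R ℕ.+ R ℕ.* R ℕ.+ (R ℕ.* R ℕ.+ 4 ℕ.* R ℕ.+ 1) ≡ suc (2 ℕ.* R) ℕ.* suc (2 ℕ.* R)
  square = ℕSolver.solve-∀

-- Lattices

basis-injective : ∀ {N J} {Λ : Sublattice N} (B : Basis Λ J) → Injective (basisMatrix (Basis.vectors B))
basis-injective {N} B a Xa≡0 = Basis.independent B a (begin
  combination (Basis.vectors B) a       ≡⟨ tabulate-cong (λ r → trans (Xa≡0 r) (sym (lookup-replicate r 0ℤ))) ⟩
  Vec.tabulate (lookup (Vec.replicate N 0ℤ)) ≡⟨ tabulate∘lookup _ ⟩
  Vec.replicate N 0ℤ                    ∎)
  where open ≡-Reasoning

-- For w = 2R this translates the box with coordinates 0, ..., 2R onto the integer points of the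
-- centred cube.
point : ∀ {w N} → ℕ → Vec (Fin (suc w)) N → Vec ℤ N
point R = Vec.map λ k → ℤ.+ toℕ k ℤ.- ℤ.+ R

point∈Cube : ∀ R {N} (v : Vec (Fin (suc (2 ℕ.* R))) N) → point R v ∈ Cube R
point∈Cube R v i rewrite lookup-map i (λ k → ℤ.+ toℕ k ℤ.- ℤ.+ R) v | ℤₚ.m-n≡m⊖n (toℕ (lookup v i)) R
  with ℕₚ.≤-total (toℕ (lookup v i)) R
... | inj₁ k≤R = subst (_≤ R) (sym (ℤₚ.∣⊖∣-≤ k≤R)) (ℕₚ.m∸n≤m R (toℕ (lookup v i)))
... | inj₂ R≤k = subst (_≤ R) (sym (trans (ℤₚ.∣m⊖n∣≡∣n⊖m∣ (toℕ (lookup v i)) R) (ℤₚ.∣⊖∣-≤ R≤k)))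
  (ℕₚ.m≤n+o⇒m∸n≤o (toℕ (lookup v i)) R
    (subst (toℕ (lookup v i) ≤_) (cong (R ℕ.+_) (ℕₚ.+-identityʳ R)) (ℕ.s≤s⁻¹ (Finₚ.toℕ<n (lookup v i)))))

-- The translation by R cancels in a difference, and differences of points of Λ stay in Λ, so
-- `spanning` supplies the coefficients.
points-congruent : ∀ {w N J} {Λ : Sublattice N} (B : Basis Λ J) R (u v : Vec (Fin (suc w)) N) →
  point R u ∈ Sublattice.Carrier Λ → point R v ∈ Sublattice.Carrier Λ → u ≡ v mod basisMatrix (Basis.vectors B)
points-congruent {Λ = Λ} B R u v u∈Λ v∈Λ = a , λ r → begin
  ℤ.+ toℕ (lookup u r) ℤ.- ℤ.+ toℕ (lookup v r)            ≡⟨ shift (ℤ.+ toℕ (lookup u r)) (ℤ.+ toℕ (lookup v r)) (ℤ.+ R) ⟩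
  (ℤ.+ toℕ (lookup u r) ℤ.- ℤ.+ R) ℤ.+ (ℤ.- (ℤ.+ toℕ (lookup v r) ℤ.- ℤ.+ R))
    ≡⟨ cong₂ ℤ._+_ (lookup-map r _ u) (trans (lookup-map r ℤ.-_ (point R v)) (cong ℤ.-_ (lookup-map r _ v))) ⟨
  lookup (point R u) r ℤ.+ lookup (Vec.map ℤ.-_ (point R v)) r  ≡⟨ lookup-zipWith ℤ._+_ r (point R u) (Vec.map ℤ.-_ (point R v)) ⟨
  lookup difference r                                      ≡⟨ cong (λ x → lookup x r) spanned ⟨
  lookup (combination (Basis.vectors B) a) r               ≡⟨ lookup∘tabulate _ r ⟩
  (basisMatrix (Basis.vectors B) · a) r                    ∎
  where
  open ≡-Reasoning
  open Sublattice Λ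
  difference = Vec.zipWith ℤ._+_ (point R u) (Vec.map ℤ.-_ (point R v))
  span = Basis.spanning B (+-closed u∈Λ (neg-closed v∈Λ))
  a = proj₁ span
  spanned : combination (Basis.vectors B) a ≡ difference
  spanned = proj₂ span
  shift : ∀ u v R → u ℤ.- v ≡ (u ℤ.- R) ℤ.+ (ℤ.- (v ℤ.- R))
  shift = solve-∀

-- Distributing the points of the cube over the cover

indicator : ∀ {n} → Fin n → Fin n → ℕ
indicator zero    zero    = 1
indicator zero    (suc j) = 0
indicator (suc i) zero    = 0
indicator (suc i) (suc j) = indicator i j

indicator≤1 : ∀ {n} (i j : Fin n) → indicator i j ≤ 1
indicator≤1 zero    zero    = ℕₚ.≤-refl
indicator≤1 zero    (suc j) = ℕ.z≤n
indicator≤1 (suc i) zero    = ℕ.z≤n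
indicator≤1 (suc i) (suc j) = indicator≤1 i j

indicator-positive : ∀ {n} (i j : Fin n) → 0 ℕ.< indicator i j → i ≡ j
indicator-positive zero    zero    _ = refl
indicator-positive (suc i) (suc j) p = cong suc (indicator-positive i j p)

sum-indicator : ∀ {n} (j : Fin n) → (∑ℕ.sum λ i → indicator i j) ≡ 1
sum-indicator {suc n} zero    = cong suc (trans (sum-const n 0) (ℕₚ.*-zeroʳ n))
sum-indicator {suc n} (suc j) = sum-indicator j

covering-bound : ∀ {J M} R (Λ : Fin M → Sublattice (suc J)) (B : ∀ i → Basis (Λ i) J) →
  (∀ x → x ∈ Cube R → ∃ λ i → x ∈ Sublattice.Carrier (Λ i)) →
  fromℕ (suc (2 ℕ.* R) ℕ.* suc (2 ℕ.* R)) ℚ.≤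
    fromℕ (2 ℕ.* R) ℚ.* ∑ℚ.sum (λ i → reciprocal (height (B i))) ℚ.+ fromℕ M
-- The bounds carry the common factor P = n^J, which is cancelled here; the box has n P points, and
-- n times that number is n² P.
covering-bound {J} {M} R Λ B cover = ℚₚ.*-cancelʳ-≤-pos (fromℕ P) {{ℚₚ.normalize-pos P 1 {{_}} {{ℕₚ.m^n≢0 n J}}}} (begin
  fromℕ (n ℕ.* n) ℚ.* fromℕ P        ≡⟨ fromℕ-* (n ℕ.* n) P ⟨
  fromℕ (n ℕ.* n ℕ.* P)              ≡⟨ cong fromℕ (trans (lemma n P) (cong (ℕ._* n) (sym points-counted))) ⟩
  fromℕ (∑ℕ.sum (λ i → total (f i)) ℕ.* n)  ≤⟨ sum-divide-bounds (λ i → total (f i)) (λ i → height (B i)) w n P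
                                              (λ i → proj₁ (attained i)) bound ⟩
  (fromℕ w ℚ.* ∑ℚ.sum (λ i → reciprocal (height (B i))) ℚ.+ fromℕ M) ℚ.* fromℕ P  ∎)
  where
  open ℚₚ.≤-Reasoning
  w n P : ℕ
  w = 2 ℕ.* R
  n = suc w
  P = n ℕ.^ J

  -- Each box point is assigned to one lattice containing it, even if several do. The sets with
  -- indicators `f i` then partition the box, and their sizes add up exactly.
  owner : Vec (Fin n) (suc J) → Fin M
  owner v = proj₁ (cover (point R v) (point∈Cube R v))

  f : Fin M → Vec (Fin n) (suc J) → ℕ
  f i v = indicator i (owner v)

  owned : ∀ i v → 0 ℕ.< f i v → point R v ∈ Sublattice.Carrier (Λ i)
  owned i v 0<f = subst (λ i → point R v ∈ Sublattice.Carrier (Λ i))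
    (sym (indicator-positive i (owner v) 0<f)) (proj₂ (cover (point R v) (point∈Cube R v)))

  attained = λ i → maxMinor-attained (basisMatrix (Basis.vectors (B i))) (basis-injective (B i))

  bound : ∀ i → total (f i) ℕ.* (height (B i) ℕ.* n) ≤ (w ℕ.+ height (B i)) ℕ.* P
  -- I is an index set whose minor attains the height in absolute value.
  bound i = let _ , I , eq = attained i in
    subst (λ D → total (f i) ℕ.* (D ℕ.* n) ≤ (w ℕ.+ D) ℕ.* P) eq
      (count-bound w (basisMatrix (Basis.vectors (B i))) I (f i) (λ v → indicator≤1 i (owner v))
        λ u v 0<fu 0<fv → points-congruent (B i) R u v (owned i u 0<fu) (owned i v 0<fv))

  points-counted : ∑ℕ.sum (λ i → total (f i)) ≡ n ℕ.* P
  points-counted = trans (sum-total f)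
    (trans (total-cong λ v → sum-indicator (owner v)) (total-one n (suc J)))

  lemma : ∀ n P → n ℕ.* n ℕ.* P ≡ n ℕ.* P ℕ.* n
  lemma = ℕSolver.solve-∀

corollary6p1 : (N M R : ℕ) → 2 ≤ N → 1 ≤ M → 1 ≤ R →
    (Λ : Fin M → Sublattice N) →
    (B : (i : Fin M) → Basis (Λ i) (N ∸ 1)) →
    ((x : Vec ℤ N) → x ∈ Cube R → ∃ λ i → x ∈ Sublattice.Carrier (Λ i)) →
    fromℕ R -ᵣ √ M ≤ᵣ fromℚ (∑ℚ.sum λ i → reciprocal (height (B i)))
corollary6p1 (suc J) M R _ _ _ Λ B cover {q} (0<s , M<s²) =
  -- That q lies in the lower cut of R - √M means that s = R - q lies in the upper cut of √M, that
  -- is 0 < s and M < s². The goal q < ρ is R - s < ρ.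
  subst (ℚ._< ρ) (solve 2 (λ r q → r :- (r :- q) := q) refl (fromℕ R) q)
    (sqrt-bound R M ρ (fromℕ R ℚ.- q) (0≤sum _ λ i → 0≤reciprocal (height (B i)))
      (covering-bound R Λ B cover) 0<s M<s²)
  where
  open ℚSolver.+-*-Solver
  ρ = ∑ℚ.sum λ i → reciprocal (height (B i))
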